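{- Let $M$ and $k$ be positive integers with $M\geq k\geq 4$, and let $G$ be a finite simple graph with maximum degree $\Delta(G)\leq M$. Then: (1) if $\mathrm{mad}(G)<\frac{12}{5}$, then $\chi^l_k(G)\leq\left\lceil\frac{M}{k-1}\right\rceil+1$; (2) if $\mathrm{mad}(G)<\frac{8}{3}$, then $\chi^l_k(G)\leq\left\lceil\frac{M}{k-1}\right\rceil+2$; (3) if $\mathrm{mad}(G)<3$, then $\chi^l_k(G)\leq\left\lceil\frac{M}{k-1}\right\rceil+3$.
   Context: All graphs are finite, simple and undirected. The maximum average degree of $G$ is $\mathrm{mad}(G)=\max\{2|E(H)|/|V(H)| : H\subseteq G\}$. A $k$-forested coloring of $G$ is a proper vertex coloring such that, for any two color classes, the subgraph induced by the union of these two classes is a forest of maximum degree less than $k$. If $L$ assigns to each vertex $v$ a list $L(v)$ of colors, $G$ is $k$-forested $L$-colorable if it has a $k$-forested coloring in which each vertex $v$ receives a color from $L(v)$; $G$ is $k$-forested $q$-choosable if it is $k$-forested $L$-colorable for every list assignment $L$ with $|L(v)|=q$ for all $v$. The $k$-forested choice number $\chi^l_k(G)$ is the smallest $q$ such that $G$ is $k$-forested $q$-choosable. -}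

module Defs where

open import Level using (0ℓ)
open import Data.Nat using (ℕ; _*_; _∸_; _≤_; _<_; _≥_; NonZero; s≤s)
import Data.Nat.Properties as ℕₚ
open import Data.Integer using (+_)
open import Data.Rational as ℚ using (ℚ)
open import Data.Fin using (Fin; _<?_)
open import Data.Fin.Subset using (Subset; _∈_; _⊆_; _∩_; _∪_; ∣_∣)
open import Data.Fin.Subset.Properties using (_∈?_; x∈p∩q⁺)
open import Data.List using (List; _∷_; _∷ʳ_; length; filter; map; allFin; cartesianProduct)
open import Data.List.Extrema.Nat using (max)
import Data.List.Membership.Propositional as List
open import Data.List.Relation.Unary.Linked using (Linked)
open import Data.List.Relation.Unary.Unique.Propositional using (Unique)
open import Data.Vec using (tabulate)
open import Data.Product using (Σ; ∃; _×_; _,_; proj₁; proj₂)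
open import Relation.Binary using (Rel; Decidable; Symmetric; Irreflexive)
open import Relation.Binary.PropositionalEquality using (_≡_; _≢_)
open import Relation.Nullary using (¬_; does; _×-dec_)

private variable
  n : ℕ

-- The vertex set is an arbitrary subset of Fin n, so that a graph and all of
-- its subgraphs have the same type.
record Graph (n : ℕ) : Set₁ where
  field
    V      : Subset n
    Adj    : Rel (Fin n) 0ℓ
    adj?   : Decidable Adj
    sym    : Symmetric Adj
    irrefl : Irreflexive _≡_ Adj
    Adj⇒∈V : ∀ {u v} → Adj u v → u ∈ V

open Graph public

record _⊑_ (H G : Graph n) : Set where
  field
    V⊆V     : V H ⊆ V G
    Adj⊆Adj : ∀ {u v} → Adj H u v → Adj G u v

order : Graph n → ℕ
order G = ∣ V G ∣

-- Each edge {u , v} is counted once, as the pair with u < v.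
size : Graph n → ℕ
size {n} G =
  length (filter (λ e → (proj₁ e <? proj₂ e) ×-dec adj? G (proj₁ e) (proj₂ e))
                 (cartesianProduct (allFin n) (allFin n)))

degree : Graph n → Fin n → ℕ
degree {n} G v = length (filter (adj? G v) (allFin n))

Δ : Graph n → ℕ
Δ {n} G = max 0 (map (degree G) (filter (_∈? V G) (allFin n)))

averageDegree : (G : Graph n) → .{{NonZero (order G)}} → ℚ
averageDegree G = + (2 * size G) ℚ./ order G

-- d is the maximum of the average degrees of the subgraphs of G with at least
-- one vertex.
record IsMad (G : Graph n) (d : ℚ) : Set₁ where
  field
    attained   : ∃ λ (H : Graph n) → H ⊑ G ×
                 Σ (NonZero (order H)) λ nz → averageDegree H {{nz}} ≡ d
    upperBound : ∀ (H : Graph n) → H ⊑ G → .{{_ : NonZero (order H)}} →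
                 averageDegree H ℚ.≤ d

_[_] : Graph n → Subset n → Graph n
G [ S ] = record
  { V      = V G ∩ S
  ; Adj    = λ u v → Adj G u v × u ∈ S × v ∈ S
  ; adj?   = λ u v → adj? G u v ×-dec (u ∈? S) ×-dec (v ∈? S)
  ; sym    = λ (uv , u∈S , v∈S) → sym G uv , v∈S , u∈S
  ; irrefl = λ u≡v (uv , _) → irrefl G u≡v uv
  ; Adj⇒∈V = λ (uv , u∈S , _) → x∈p∩q⁺ (Adj⇒∈V G uv , u∈S)
  }

-- The cycle v , vs₁ , … , vsₘ , v with m ≥ 2 (at least three vertices).
record IsCycle (G : Graph n) (v : Fin n) (vs : List (Fin n)) : Set where
  field
    closed   : Linked (Adj G) (v ∷ (vs ∷ʳ v))
    distinct : Unique (v ∷ vs)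
    long     : 2 ≤ length vs

IsForest : Graph n → Set
IsForest G = ∀ v vs → ¬ IsCycle G v vs

-- Only the values of a coloring (and of a list assignment, below) on V G
-- matter.
Coloring : ℕ → Set
Coloring n = Fin n → ℕ

colorClass : Coloring n → ℕ → Subset n
colorClass c i = tabulate (λ v → does (c v ℕₚ.≟ i))

record IsForestedColoring (k : ℕ) (G : Graph n) (c : Coloring n) : Set where
  field
    proper    : ∀ {u v} → Adj G u v → c u ≢ c v
    forest    : ∀ i j → i ≢ j → IsForest (G [ colorClass c i ∪ colorClass c j ])
    maxDegree : ∀ i j → i ≢ j → Δ (G [ colorClass c i ∪ colorClass c j ]) < k

ListAssignment : ℕ → Set
ListAssignment n = Fin n → List ℕ

-- Every list has exactly q distinct colors.
HasSize : Graph n → ℕ → ListAssignment n → Set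
HasSize G q L = ∀ v → v ∈ V G → Unique (L v) × length (L v) ≡ q

ForestedListColorable : ℕ → (G : Graph n) → ListAssignment n → Set
ForestedListColorable k G L =
  ∃ λ c → IsForestedColoring k G c × (∀ v → v ∈ V G → c v List.∈ L v)

ForestedChoosable : ℕ → Graph n → ℕ → Set
ForestedChoosable k G q = ∀ L → HasSize G q L → ForestedListColorable k G L

record IsForestedChoiceNumber (k : ℕ) (G : Graph n) (χ : ℕ) : Set where
  field
    choosable : ForestedChoosable k G χ
    least     : ∀ q → ForestedChoosable k G q → χ ≤ q

k≥4⇒k∸1≢0 : ∀ {k} → k ≥ 4 → NonZero (k ∸ 1)
k≥4⇒k∸1≢0 (s≤s (s≤s _)) = _

{-# OPTIONS --safe #-}

-- Put t = ⌈ M / (k ∸ 1) ⌉ ≥ 2.  A vertex u with an uncoloured neighbour v sees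
-- fewer than t colours k ∸ 1 times, so together with its own colour it forbids at
-- most t colours at v.  A second coloured neighbour w of v of small degree forbids
-- only its own colour or, if u and w share a colour and a two-coloured cycle might
-- close through v, the colours around w.  This makes the following configurations
-- reducible, for lists of size t + 1, t + 2, t + 3 as appropriate: a vertex of
-- degree at most 1; a vertex of degree 2 with neighbours of small degree; a vertex
-- of degree 3, 4 or 5 almost all of whose neighbours have degree 2.
-- Discharging from large degrees to the vertices of degree 2 finds one of them in
-- every nonempty subgraph.
-- To obtain the least χ constructively, choosability is decided by renaming the
-- colours of a list assignment into a finite palette.

module Submission where

open import Defs hiding (sym)
open import Data.Nat as ℕ using (ℕ; zero; suc; _+_; _*_; _∸_; _≤_; _<_; _≥_; z≤n; s≤s; NonZero)
open import Data.Nat.Properties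
import Data.Nat.ListAction as ListAction
open import Data.Nat.Solver using (module +-*-Solver)
open import Data.Integer as ℤ using (ℤ; +_)
import Data.Integer.Properties as ℤₚ
import Data.Integer.DivMod as ℤᵈ
open import Data.Rational as ℚ using (ℚ; ceiling)
import Data.Rational.Properties as ℚₚ
import Data.Rational.Unnormalised as ℚᵘ
import Data.Rational.Unnormalised.Properties as ℚᵘₚ
open import Data.Bool using (true; false; if_then_else_)
open import Data.Fin as Fin using (Fin; zero; suc; toℕ)
import Data.Fin.Properties as Finₚ
open import Data.Fin.Subset using (Subset; ∁; ⁅_⁆; _∪_; ∣_∣) renaming (_∈_ to _∈ˢ_)
import Data.Fin.Subset.Properties as Subsetₚ
open import Data.List using (List; []; _∷_; _++_; _∷ʳ_; length; filter; map; allFin; tabulate; deduplicate; cartesianProduct)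
open import Data.List.Properties using (length-++; length-++-sucʳ; length-map; length-filter; filter-++; filter-accept; filter-reject; map-tabulate; length-tabulate)
open import Data.List.Extrema.Nat using (xs≤max; max<v⁺)
open import Data.List.Membership.Propositional using (_∈_; _∉_; find)
open import Data.List.Membership.Propositional.Properties using (∈-∃++; ∈-++⁺ˡ; ∈-++⁺ʳ; ∈-++⁻; ∈-map⁺; ∈-map⁻; ∈-filter⁺; ∈-filter⁻; ∈-allFin; ∈-deduplicate⁺; ∈-deduplicate⁻)
import Data.List.Membership.DecPropositional as DecMembership
open DecMembership ℕ._≟_ using () renaming (_∈?_ to _∈ℕ?_)
open import Data.List.Relation.Unary.Any as Any using (here; there)
open import Data.List.Relation.Unary.All as All using (All; []; _∷_)
import Data.List.Relation.Unary.All.Properties as Allₚ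
open import Data.List.Relation.Unary.AllPairs using ([]; _∷_)
open import Data.List.Relation.Unary.Linked as Linked using (Linked; [-]; _∷_)
open import Data.List.Relation.Unary.Unique.Propositional using (Unique)
import Data.List.Relation.Unary.Unique.Propositional.Properties as Uniqueₚ
import Data.List.Relation.Unary.Unique.DecPropositional as DecUnique
import Data.List.Relation.Unary.Unique.DecPropositional.Properties as DecUniqueₚ
open import Data.Vec as Vec using (Vec; []; _∷_)
import Data.Vec.Properties as Vecₚ
open import Data.Vec.Membership.Propositional.Properties using (∈-toList⁺; ∈-toList⁻; ∈-tabulate⁺; toAny)
import Data.Vec.Relation.Unary.Any.Properties as VecAnyₚ
open import Data.Vec.Functional using (updateAt)
open import Data.Vec.Functional.Properties using (updateAt-updates; updateAt-minimal)
open import Algebra.Properties.Semiring.Sum +-*-semiring using (sum; sum-cong-≗; ∑-distrib-+; ∑-comm; *-distribˡ-sum)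
open import Data.Product using (∃; ∃₂; ∃-syntax; _×_; _,_; proj₁; proj₂)
open import Data.Sum as Sum using (_⊎_; inj₁; inj₂; [_,_]′)
open import Function using (_∘_; id; const; case_of_)
open import Relation.Binary using (tri<; tri≈; tri>)
open import Relation.Binary.PropositionalEquality using (_≡_; _≢_; refl; sym; trans; cong; cong₂; subst; subst₂; module ≡-Reasoning)
open import Relation.Nullary using (¬_; Dec; yes; no; does; contradiction)
open import Relation.Nullary.Decidable using (map′; ¬?; _×-dec_; _⊎-dec_; _→-dec_; decidable-stable; dec-true; dec-false)

-- The numbers in the configurations come from `t ≥ 2` and `k ∸ 1 ≥ 3`. A vertex of degree at most 3
-- with an uncoloured neighbour has at most two coloured ones, too few for any colour to occur
-- `k ∸ 1` times; a vertex of degree 4 or 5 has at most four coloured ones, so at most one colour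
-- occurs that often. A centre of degree 3 or more cannot be handled by deleting one neighbour `v`
-- of degree 2: the remaining colouring may give both neighbours of `v` the same colour, and
-- avoiding all colours around the centre could then use up the whole list. So the centre and all
-- its neighbours of degree 2 are deleted together, and the centre is coloured afresh with the far
-- ends in view. The charges `s` and `p` satisfy `p / s` = 12/5, 8/3, 3 and are scaled so that a
-- vertex of degree 2 lacks exactly `p ∸ 2 * s` = 2 units each time. It stays poor only if its two
-- neighbours together give less than 2.

private variable
  n : ℕ
  A : Set

-- Counting distinct elements and colours in lists

Unique∧⊆⇒length≤ : ∀ {xs ys : List A} → Unique xs → (∀ {x} → x ∈ xs → x ∈ ys) → length xs ≤ length ys
Unique∧⊆⇒length≤ [] _ = z≤n
Unique∧⊆⇒length≤ {xs = x ∷ xs} (x∉xs ∷ xs!) xs⊆ys with as , bs , refl ← ∈-∃++ (xs⊆ys (here refl)) =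
  ≤-trans (s≤s (Unique∧⊆⇒length≤ xs! λ y∈xs → drop-x y∈xs (∈-++⁻ as (xs⊆ys (there y∈xs)))))
          (≤-reflexive (sym (length-++-sucʳ as x bs)))
  where
  drop-x : ∀ {y} → y ∈ xs → y ∈ as ⊎ y ∈ x ∷ bs → y ∈ as ++ bs
  drop-x y∈xs (inj₁ y∈as)         = ∈-++⁺ˡ y∈as
  drop-x y∈xs (inj₂ (here refl))  = contradiction refl (All.lookup x∉xs y∈xs)
  drop-x y∈xs (inj₂ (there y∈bs)) = ∈-++⁺ʳ as y∈bs

pick-avoiding : ∀ (xs F : List ℕ) → Unique xs → length F < length xs → ∃ λ a → a ∈ xs × a ∉ F
pick-avoiding xs F xs! F<xs with Any.any? (λ a → ¬? (a ∈ℕ? F)) xs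
... | yes found = find found
... | no none = contradiction (Unique∧⊆⇒length≤ xs! λ a∈xs → in-F a∈xs) (<⇒≱ F<xs)
  where
  in-F : ∀ {a} → a ∈ xs → a ∈ F
  in-F {a} a∈xs = decidable-stable (a ∈ℕ? F) λ a∉F → none (Any.map (λ { refl → a∉F }) a∈xs)

count : (A → ℕ) → ℕ → List A → ℕ
count c i xs = length (filter (λ x → c x ℕ.≟ i) xs)

module _ (c : A → ℕ) (i : ℕ) where

  private
    other? : ∀ x → Dec (¬ c x ≡ i)
    other? x = ¬? (c x ℕ.≟ i)

  length≡count+others : ∀ xs → length xs ≡ count c i xs + length (filter other? xs)
  length≡count+others [] = refl
  length≡count+others (x ∷ xs) with does (c x ℕ.≟ i)
  ... | true  = cong suc (length≡count+others xs)
  ... | false = trans (cong suc (length≡count+others xs)) (sym (+-suc _ _))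

  count-others : ∀ {j} → j ≢ i → ∀ xs → count c j (filter other? xs) ≡ count c j xs
  count-others j≢i [] = refl
  count-others {j} j≢i (x ∷ xs) = case c x ℕ.≟ i of λ where
      (yes p) → begin
        count c j (filter other? (x ∷ xs))  ≡⟨ cong (count c j) (filter-reject other? {xs = xs} (λ ¬p → ¬p p)) ⟩
        count c j (filter other? xs)        ≡⟨ count-others j≢i xs ⟩
        count c j xs                        ≡⟨ cong length (filter-reject j? {xs = xs} (λ q → j≢i (trans (sym q) p))) ⟨
        count c j (x ∷ xs)                  ∎
      (no ¬p) → begin
        count c j (filter other? (x ∷ xs))  ≡⟨ cong (count c j) (filter-accept other? {xs = xs} ¬p) ⟩
        count c j (x ∷ filter other? xs)    ≡⟨ count-∷ (filter other? xs) xs (count-others j≢i xs) ⟩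
        count c j (x ∷ xs)                  ∎
    where
    open ≡-Reasoning
    j? : ∀ y → Dec (c y ≡ j)
    j? y = c y ℕ.≟ j
    count-∷ : ∀ ys zs → count c j ys ≡ count c j zs → count c j (x ∷ ys) ≡ count c j (x ∷ zs)
    count-∷ ys zs eq with does (c x ℕ.≟ j)
    ... | true  = cong suc eq
    ... | false = eq

-- Classes of distinct colours are disjoint: splitting off the class of one colour leaves the counts
-- of the others unchanged.
frequent-colours-bound : ∀ (c : A → ℕ) m {F xs} → Unique F → (∀ {i} → i ∈ F → m ≤ count c i xs) →
                         length F * m ≤ length xs
frequent-colours-bound c m [] _ = z≤n
frequent-colours-bound c m {i ∷ F} {xs} (i∉F ∷ F!) often = begin
  m + length F * m            ≤⟨ +-mono-≤ (often (here refl)) (frequent-colours-bound c m {xs = rest} F! λ {j} j∈F →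
                                   ≤-trans (often (there j∈F))
                                     (≤-reflexive (sym (count-others c i (All.lookup i∉F j∈F ∘ sym) xs)))) ⟩
  count c i xs + length rest  ≡⟨ length≡count+others c i xs ⟨
  length xs                   ∎
  where
  open ≤-Reasoning
  rest : List _
  rest = filter (λ x → ¬? (c x ℕ.≟ i)) xs

-- Neighbourhoods and vertex deletion

N : Graph n → Fin n → List (Fin n)
N H v = filter (adj? H v) (allFin _)

module _ (H : Graph n) where

  ∈N⁺ : ∀ {u v} → Adj H v u → u ∈ N H v
  ∈N⁺ {u} {v} vu = ∈-filter⁺ (adj? H v) (∈-allFin u) vu

  ∈N⁻ : ∀ {u v} → u ∈ N H v → Adj H v u
  ∈N⁻ {v = v} u∈N = proj₂ (∈-filter⁻ (adj? H v) {xs = allFin _} u∈N)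

  N! : ∀ v → Unique (N H v)
  N! v = Uniqueₚ.filter⁺ (adj? H v) (Uniqueₚ.allFin⁺ _)

  degree≤ : ∀ {v xs} → (∀ {u} → Adj H v u → u ∈ xs) → degree H v ≤ length xs
  degree≤ nbrs⊆xs = Unique∧⊆⇒length≤ (N! _) (nbrs⊆xs ∘ ∈N⁻)

_−_ : Graph n → Fin n → Graph n
H − v = H [ ∁ ⁅ v ⁆ ]

infixl 6 _−_

⊑-trans : ∀ {F H K : Graph n} → F ⊑ H → H ⊑ K → F ⊑ K
⊑-trans F⊑H H⊑K = record
  { V⊆V     = _⊑_.V⊆V H⊑K ∘ _⊑_.V⊆V F⊑H
  ; Adj⊆Adj = _⊑_.Adj⊆Adj H⊑K ∘ _⊑_.Adj⊆Adj F⊑H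
  }

⊑-refl : ∀ {H : Graph n} → H ⊑ H
⊑-refl = record { V⊆V = id ; Adj⊆Adj = id }

degree-mono : ∀ {F H : Graph n} → F ⊑ H → ∀ v → degree F v ≤ degree H v
degree-mono {F = F} {H} F⊑H v = Unique∧⊆⇒length≤ (N! F v) (∈N⁺ H ∘ _⊑_.Adj⊆Adj F⊑H ∘ ∈N⁻ F)

module _ {H : Graph n} {v : Fin n} where

  private
    ∈∁⁺ : ∀ {x} → x ≢ v → x ∈ˢ ∁ ⁅ v ⁆
    ∈∁⁺ = Subsetₚ.x∉p⇒x∈∁p ∘ Subsetₚ.x≢y⇒x∉⁅y⁆

    ∈∁⁻ : ∀ {x} → x ∈ˢ ∁ ⁅ v ⁆ → x ≢ v
    ∈∁⁻ = Subsetₚ.x∉⁅y⁆⇒x≢y ∘ Subsetₚ.x∈∁p⇒x∉p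

  Adj-−⁺ : ∀ {x y} → Adj H x y → x ≢ v → y ≢ v → Adj (H − v) x y
  Adj-−⁺ xy x≢v y≢v = xy , ∈∁⁺ x≢v , ∈∁⁺ y≢v

  Adj-−⁻ : ∀ {x y} → Adj (H − v) x y → Adj H x y × x ≢ v × y ≢ v
  Adj-−⁻ (xy , x∈ , y∈) = xy , ∈∁⁻ x∈ , ∈∁⁻ y∈

  V-−⁺ : ∀ {x} → x ∈ˢ V H → x ≢ v → x ∈ˢ V (H − v)
  V-−⁺ x∈V x≢v = Subsetₚ.x∈p∩q⁺ (x∈V , ∈∁⁺ x≢v)

  V-−⁻ : ∀ {x} → x ∈ˢ V (H − v) → x ∈ˢ V H × x ≢ v
  V-−⁻ x∈ = let x∈V , x∈∁ = Subsetₚ.x∈p∩q⁻ (V H) _ x∈ in x∈V , ∈∁⁻ x∈∁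

  −⊑ : (H − v) ⊑ H
  −⊑ = record { V⊆V = proj₁ ∘ V-−⁻ ; Adj⊆Adj = proj₁ ∘ Adj-−⁻ }

  order-− : v ∈ˢ V H → order (H − v) < order H
  order-− v∈V = Subsetₚ.p⊂q⇒∣p∣<∣q∣ (proj₁ ∘ V-−⁻ , v , v∈V , λ v∈ → proj₂ (V-−⁻ v∈) refl)

  degree-− : ∀ {u} → Adj H u v → degree (H − v) u < degree H u
  degree-− {u} uv = Unique∧⊆⇒length≤ (All.tabulate v∉ ∷ N! (H − v) u)
    λ { (here refl) → ∈N⁺ H uv ; (there x∈) → ∈N⁺ H (proj₁ (Adj-−⁻ (∈N⁻ (H − v) x∈))) }
    where
    v∉ : ∀ {x} → x ∈ N (H − v) u → v ≢ x
    v∉ x∈ refl = proj₂ (proj₂ (Adj-−⁻ (∈N⁻ (H − v) x∈))) refl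

Adj⇒∈Vʳ : ∀ (H : Graph n) {u v} → Adj H u v → v ∈ˢ V H
Adj⇒∈Vʳ H uv = Adj⇒∈V H (Graph.sym H uv)

-- Extending a colouring to one more vertex

-- A graph is a forest iff it has no nonempty core; unlike cycles, cores need no
-- rotation or reordering when a vertex is added to the graph.
IsCore : Graph n → (Fin n → Set) → Set
IsCore H C = ∀ {x} → C x → ∃₂ λ y z → y ≢ z × (C y × Adj H x y) × (C z × Adj H x z)

-- The invariant of the induction. In a proper colouring the neighbours of `u` within the classes of
-- `c u` and of another colour `i` all have colour `i`, so `bounded` expresses the degree condition
-- by counting a single colour. `coreFree` expresses the forest condition.
record IsCoreFreeColoring (k : ℕ) (L : ListAssignment n) (H : Graph n) (c : Coloring n) : Set₁ where
  field
    proper   : ∀ {u v} → Adj H u v → c u ≢ c v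
    bounded  : ∀ u i → count c i (N H u) < k
    coreFree : ∀ {C : Fin n → Set} {i j} → IsCore H C → (∀ {x} → C x → c x ≡ i ⊎ c x ≡ j) → ∀ {x} → ¬ C x
    listed   : ∀ {v} → v ∈ˢ V H → c v ∈ L v

-- The colours that a further neighbour of `u` must not receive, since the new occurrence would
-- bring the count to `k`. Searching only the colours present around `u` misses none of them when
-- `2 ≤ k`; without duplicates the list can be counted.
saturated : ℕ → Coloring n → Graph n → Fin n → List ℕ
saturated k c H u = filter (λ i → k ℕ.≤? suc (count c i (N H u))) (deduplicate ℕ._≟_ (map c (N H u)))

count>0⇒∈ : ∀ (c : A → ℕ) i xs → 0 < count c i xs → ∃ λ x → x ∈ xs × c x ≡ i
count>0⇒∈ c i xs 0<count with filter (λ x → c x ℕ.≟ i) xs in eq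
... | x ∷ _ = x , ∈-filter⁻ (λ x → c x ℕ.≟ i) {xs = xs} (subst (x ∈_) (sym eq) (here refl))

∈saturated : ∀ {k c} {H : Graph n} {u i} → 2 ≤ k → k ≤ suc (count c i (N H u)) → i ∈ saturated k c H u
∈saturated {k = k} {c} {H} {u} {i} 2≤k k≤ with x , x∈N , refl ← count>0⇒∈ c i (N H u) (ℕ.s≤s⁻¹ (≤-trans 2≤k k≤)) =
  ∈-filter⁺ (λ i → k ℕ.≤? suc (count c i (N H u))) (∈-deduplicate⁺ ℕ._≟_ (∈-map⁺ c x∈N)) k≤

-- Each saturated colour takes up at least `k ∸ 1` neighbours of `u`.
∣saturated∣< : ∀ {k c} {H : Graph n} {u} m → degree H u < m * (k ∸ 1) → length (saturated k c H u) < m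
∣saturated∣< {k = k} {c} {H} {u} m d< = *-cancelʳ-< (k ∸ 1) _ _ (≤-<-trans
  (frequent-colours-bound c (k ∸ 1) {xs = N H u}
    (Uniqueₚ.filter⁺ (λ i → k ℕ.≤? suc (count c i (N H u))) (DecUniqueₚ.deduplicate-! ℕ._≟_ (map c (N H u))))
    λ {i} i∈ → ∸-monoˡ-≤ 1 (proj₂ (∈-filter⁻ (λ i → k ℕ.≤? suc (count c i (N H u)))
                                              {xs = deduplicate ℕ._≟_ (map c (N H u))} i∈)))
  d<)

-- The alternation of two colours along a properly coloured path of three vertices.
two-valued : ∀ {i j p q r : ℕ} → p ≡ i ⊎ p ≡ j → q ≡ i ⊎ q ≡ j → r ≡ i ⊎ r ≡ j → p ≢ q → q ≢ r → p ≡ r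
two-valued (inj₁ refl) (inj₁ refl) _           p≢q _   = contradiction refl p≢q
two-valued (inj₁ refl) (inj₂ refl) (inj₁ refl) _   _   = refl
two-valued (inj₁ refl) (inj₂ refl) (inj₂ refl) _   q≢r = contradiction refl q≢r
two-valued (inj₂ refl) (inj₁ refl) (inj₁ refl) _   q≢r = contradiction refl q≢r
two-valued (inj₂ refl) (inj₁ refl) (inj₂ refl) _   _   = refl
two-valued (inj₂ refl) (inj₂ refl) _           p≢q _   = contradiction refl p≢q

-- A two-coloured cycle through `v` would pass through two neighbours of `v` of equal colour, each
-- with a further neighbour of colour `α`. `separated` forbids exactly this pattern, and
-- `unsaturated` protects the counts around the neighbours of `v`.
module _ {k : ℕ} {L : ListAssignment n} {H : Graph n} {c : Coloring n} {v : Fin n} (α : ℕ)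
         (good : IsCoreFreeColoring k L (H − v) c)
         (α∈Lv : v ∈ˢ V H → α ∈ L v)
         (small : degree H v < k)
         (new : ∀ {u} → Adj H v u → c u ≢ α)
         (unsaturated : ∀ {u} → Adj H v u → suc (count c α (N (H − v) u)) < k)
         (separated : ∀ {u w x y} → Adj H v u → Adj H v w → u ≢ w → c u ≡ c w →
                      Adj (H − v) u x → Adj (H − v) w y → c x ≡ α → c y ≢ α)
  where

  private
    module Good = IsCoreFreeColoring good

    c′ : Coloring n
    c′ = updateAt c v (const α)

    at-v : c′ v ≡ α
    at-v = updateAt-updates v c

    off-v : ∀ {x} → x ≢ v → c′ x ≡ c x
    off-v x≢v = updateAt-minimal _ v c x≢v

    nbr≢v : ∀ {u} → Adj H v u → u ≢ v
    nbr≢v vu refl = irrefl H refl vu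

    new′ : ∀ {u} → Adj H v u → c′ u ≢ α
    new′ vu eq = new vu (trans (sym (off-v (nbr≢v vu))) eq)

    proper : ∀ {u w} → Adj H u w → c′ u ≢ c′ w
    proper {u} {w} uw eq with u Fin.≟ v | w Fin.≟ v
    ... | yes refl | _        = new′ uw (trans (sym eq) at-v)
    ... | no _     | yes refl = new′ (Graph.sym H uw) (trans eq at-v)
    ... | no u≢v   | no w≢v   =
      Good.proper (Adj-−⁺ {H = H} uw u≢v w≢v) (trans (sym (off-v u≢v)) (trans eq (off-v w≢v)))

    class? : ∀ (d : Coloring n) i x → Dec (d x ≡ i)
    class? d i x = d x ℕ.≟ i

    class-! : ∀ i u → Unique (filter (class? c′ i) (N H u))
    class-! i u = Uniqueₚ.filter⁺ (class? c′ i) (N! H u)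

    ∈class : ∀ {i u x} → x ∈ filter (class? c′ i) (N H u) → u ≢ v → x ≢ v →
             x ∈ filter (class? c i) (N (H − v) u)
    ∈class {i} {u} x∈ u≢v x≢v = let x∈N , c′x≡i = ∈-filter⁻ (class? c′ i) {xs = N H u} x∈ in
      ∈-filter⁺ (class? c i) (∈N⁺ (H − v) (Adj-−⁺ {H = H} (∈N⁻ H x∈N) u≢v x≢v))
                (trans (sym (off-v x≢v)) c′x≡i)

    -- At `v` the degree bound suffices, around a neighbour of `v` only `α` gains an occurrence, and
    -- every other count is inherited from `H − v`.
    bounded : ∀ u i → count c′ i (N H u) < k
    bounded u i with u Fin.≟ v | adj? H u v ×-dec (i ℕ.≟ α)
    ... | yes refl | _ = ≤-<-trans (length-filter (class? c′ i) (N H u)) small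
    ... | no u≢v | yes (uv , refl) = ≤-<-trans (Unique∧⊆⇒length≤ (class-! i u) ⊆v∷) (unsaturated (Graph.sym H uv))
      where
      ⊆v∷ : ∀ {x} → x ∈ filter (class? c′ i) (N H u) → x ∈ v ∷ filter (class? c i) (N (H − v) u)
      ⊆v∷ {x} x∈ with x Fin.≟ v
      ... | yes x≡v = here x≡v
      ... | no x≢v  = there (∈class x∈ u≢v x≢v)
    ... | no u≢v | no ¬uvα = ≤-<-trans (Unique∧⊆⇒length≤ (class-! i u) λ {x} x∈ → ∈class x∈ u≢v (≢v x∈)) (Good.bounded u i)
      where
      ≢v : ∀ {x} → x ∈ filter (class? c′ i) (N H u) → x ≢ v
      ≢v x∈ refl = let x∈N , c′x≡i = ∈-filter⁻ (class? c′ i) {xs = N H u} x∈ in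
        ¬uvα (∈N⁻ H x∈N , trans (sym c′x≡i) at-v)

    module _ {C : Fin n → Set} {i j : ℕ} (core : IsCore H C) (bichromatic : ∀ {x} → C x → c′ x ≡ i ⊎ c′ x ≡ j) where

      -- Of the two core neighbours of `u` at least one differs from `v`, and by alternation it has
      -- the colour of `v`.
      α-neighbour : C v → ∀ {u} → C u → Adj H v u → ∃ λ x → Adj (H − v) u x × c x ≡ α
      α-neighbour Cv {u} Cu vu with core Cu
      ... | x , y , x≢y , (Cx , ux) , (Cy , uy) = case x Fin.≟ v of λ where
          (no x≢v)   → α-coloured Cx ux x≢v
          (yes refl) → α-coloured Cy uy (x≢y ∘ sym)
        where
        α-coloured : ∀ {z} → C z → Adj H u z → z ≢ v → ∃ λ x → Adj (H − v) u x × c x ≡ α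
        α-coloured {z} Cz uz z≢v = z , Adj-−⁺ {H = H} uz (nbr≢v vu) z≢v ,
          trans (sym (off-v z≢v)) (trans
            (sym (two-valued (bichromatic Cv) (bichromatic Cu) (bichromatic Cz) (proper vu) (proper uz))) at-v)

      v∉core : ¬ C v
      v∉core Cv with u , w , u≢w , (Cu , vu) , (Cw , vw) ← core Cv
        with x , ux , cx≡α ← α-neighbour Cv Cu vu | y , wy , cy≡α ← α-neighbour Cv Cw vw =
        separated vu vw u≢w cu≡cw ux wy cx≡α cy≡α
        where
        cu≡cw : c u ≡ c w
        cu≡cw = trans (sym (off-v (nbr≢v vu))) (trans
          (two-valued (bichromatic Cu) (bichromatic Cv) (bichromatic Cw) (proper vu ∘ sym) (proper vw))
          (off-v (nbr≢v vw)))

      -- A core that misses `v` is already a core of `H − v` under the old colouring.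
      no-core : ∀ {x} → ¬ C x
      no-core = Good.coreFree
        (λ Cx → let y , z , y≢z , (Cy , xy) , (Cz , xz) = core Cx in
                y , z , y≢z , (Cy , Adj-−⁺ {H = H} xy (≢v Cx) (≢v Cy)) , (Cz , Adj-−⁺ {H = H} xz (≢v Cx) (≢v Cz)))
        (λ Cx → subst (λ m → m ≡ i ⊎ m ≡ j) (off-v (≢v Cx)) (bichromatic Cx))
        where
        ≢v : ∀ {x} → C x → x ≢ v
        ≢v Cx refl = v∉core Cx

  extend : IsCoreFreeColoring k L H c′
  extend = record
    { proper   = proper
    ; bounded  = bounded
    ; coreFree = no-core
    ; listed   = λ {x} x∈V → case x Fin.≟ v of λ where
        (yes refl) → subst (_∈ L x) (sym at-v) (α∈Lv x∈V)
        (no x≢v)   → subst (_∈ L x) (sym (off-v x≢v)) (Good.listed (V-−⁺ {H = H} x∈V x≢v))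
    }

Colourable : ℕ → ListAssignment n → Graph n → Set₁
Colourable k L H = ∃ (IsCoreFreeColoring k L H)

-- t plays the role of ⌈ M / (k ∸ 1) ⌉.
record Admissible (k t q : ℕ) (L : ListAssignment n) (H : Graph n) : Set where
  field
    lists        : HasSize H q L
    degree-bound : ∀ v → degree H v ≤ t * (k ∸ 1)

Admissible-⊑ : ∀ {k t q L} {F H : Graph n} → F ⊑ H → Admissible k t q L H → Admissible k t q L F
Admissible-⊑ F⊑H adm = record
  { lists        = λ v v∈V → Admissible.lists adm v (_⊑_.V⊆V F⊑H v∈V)
  ; degree-bound = λ v → ≤-trans (degree-mono F⊑H v) (Admissible.degree-bound adm v)
  }

-- The list `E` of extra forbidden colours lets the centre of a star avoid the colours of far ends
-- that are not adjacent to it; agreement off `v` keeps such choices valid later on.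
Extension : ℕ → ListAssignment n → Graph n → Fin n → Coloring n → List ℕ → Set₁
Extension k L H v c E = ∃ λ c′ → IsCoreFreeColoring k L H c′ × (∀ {x} → x ≢ v → c′ x ≡ c x) × c′ v ∉ E

module _ {k t q : ℕ} {L : ListAssignment n} (k≥4 : k ≥ 4) where

  private
    k≥2 : 2 ≤ k
    k≥2 = ≤-trans (s≤s (s≤s z≤n)) k≥4

  module _ {H : Graph n} (adm : Admissible k t q L H) {v : Fin n} (v∈V : v ∈ˢ V H)
           {c : Coloring n} (good : IsCoreFreeColoring k L (H − v) c) where

    private
      sat : Fin n → List ℕ
      sat = saturated k c (H − v)

      unsaturated : ∀ {α u} → α ∉ sat u → suc (count c α (N (H − v) u)) < k
      unsaturated {α} {u} α∉ = ≰⇒> λ k≤ → α∉ (∈saturated {H = H − v} {u = u} k≥2 k≤)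

      -- Each extension below consists in finding a list `F` of fewer than `q` colours such that any
      -- colour outside `F` is safe at `v`.
      extend-avoiding : ∀ F E → length F < q → degree H v < k →
        (∀ {α} → α ∉ F → (∀ {u} → Adj H v u → c u ≢ α × α ∉ sat u) × α ∉ E ×
          (∀ {u w x y} → Adj H v u → Adj H v w → u ≢ w → c u ≡ c w →
                         Adj (H − v) u x → Adj (H − v) w y → c x ≡ α → c y ≢ α)) →
        Extension k L H v c E
      extend-avoiding F E F<q small allowed with Lv! , ∣Lv∣≡q ← Admissible.lists adm v v∈V
        with α , α∈Lv , α∉F ← pick-avoiding (L v) F Lv! (subst (length F <_) (sym ∣Lv∣≡q) F<q)
        with at-nbrs , α∉E , separated ← allowed α∉F =
        updateAt c v (const α) ,
        extend α good (const α∈Lv) small (proj₁ ∘ at-nbrs) (λ {u} vu → unsaturated {u = u} (proj₂ (at-nbrs vu))) separated ,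
        (λ x≢v → updateAt-minimal _ v c x≢v) ,
        subst (_∉ E) (sym (updateAt-updates v c)) α∉E

    extend-isolated : ∀ E → length E < q → (∀ {x} → ¬ Adj H v x) → Extension k L H v c E
    extend-isolated E E<q no-nbr = extend-avoiding E E E<q
      (≤-<-trans (degree≤ H {xs = []} λ vx → contradiction vx no-nbr) (≤-trans (s≤s z≤n) k≥4))
      λ α∉E → (λ vx → contradiction vx no-nbr) , α∉E , λ vx → contradiction vx no-nbr

    -- No cycle passes through a vertex with a single neighbour. That neighbour forbids its own
    -- colour and fewer than `t` saturated ones.
    extend-leaf : ∀ E {u} → t + length E < q → Adj H v u → (∀ {x} → Adj H v x → x ≡ u) → Extension k L H v c E
    extend-leaf E {u} t+E<q vu only-u = extend-avoiding F E F<q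
      (≤-<-trans (degree≤ H {xs = u ∷ []} (here ∘ only-u)) k≥2)
      λ α∉F → (λ vx → case only-u vx of λ { refl →
                  (λ cu≡α → α∉F (here (sym cu≡α))) , (λ α∈ → α∉F (there (∈-++⁺ˡ α∈))) }) ,
               (λ α∈E → α∉F (there (∈-++⁺ʳ (sat u) α∈E))) ,
               λ vx vy x≢y → contradiction (trans (only-u vx) (sym (only-u vy))) x≢y
      where
      F : List ℕ
      F = c u ∷ sat u ++ E
      F<q : length F < q
      F<q = ≤-<-trans (≤-trans (≤-reflexive (cong suc (length-++ (sat u))))
        (+-monoˡ-≤ (length E) (∣saturated∣< {H = H − v} {u} t
          (<-≤-trans (degree-− {H = H} (Graph.sym H vu)) (Admissible.degree-bound adm u))))) t+E<q

    module _ {u w : Fin n} (uw-nbrs : ∀ {x} → Adj H v x → x ≡ u ⊎ x ≡ w) where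

      private
        small : degree H v < k
        small = ≤-<-trans (degree≤ H {xs = u ∷ w ∷ []} λ vx → case uw-nbrs vx of λ where
          (inj₁ x≡u) → here x≡u
          (inj₂ x≡w) → there (here x≡w)) (≤-trans (s≤s (s≤s (s≤s z≤n))) k≥4)

      -- Two differently coloured neighbours of `v` cannot lie with `v` on a two-coloured cycle, so
      -- only their own colours and the saturated ones matter.
      extend-distinct : c u ≢ c w → 2 + (length (sat u) + length (sat w)) < q → Extension k L H v c []
      extend-distinct cu≢cw F<q = extend-avoiding F []
        (subst (λ l → 2 + l < q) (sym (length-++ (sat u))) F<q) small
        λ α∉F → (λ vx → case uw-nbrs vx of λ where
                   (inj₁ refl) → (λ cu≡α → α∉F (here (sym cu≡α))) , (λ α∈ → α∉F (there (there (∈-++⁺ˡ α∈))))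
                   (inj₂ refl) → (λ cw≡α → α∉F (there (here (sym cw≡α)))) , (λ α∈ → α∉F (there (there (∈-++⁺ʳ (sat u) α∈))))) ,
                (λ ()) ,
                λ vx vy x≢y cx≡cy → contradiction cx≡cy (distinct (uw-nbrs vx) (uw-nbrs vy) x≢y)
        where
        F : List ℕ
        F = c u ∷ c w ∷ sat u ++ sat w
        distinct : ∀ {x y} → x ≡ u ⊎ x ≡ w → y ≡ u ⊎ y ≡ w → x ≢ y → c x ≢ c y
        distinct (inj₁ refl) (inj₁ refl) x≢y _ = x≢y refl
        distinct (inj₁ refl) (inj₂ refl) _     = cu≢cw
        distinct (inj₂ refl) (inj₁ refl) _     = cu≢cw ∘ sym
        distinct (inj₂ refl) (inj₂ refl) x≢y _ = x≢y refl

      -- If u and w share a colour, a colour that does not occur around w cannot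
      -- close a cycle through v.
      extend-thread : 2 + (length (sat u) + length (sat w)) < q →
                      1 + (length (sat u) + degree (H − v) w) < q → Extension k L H v c []
      extend-thread F<q F′<q with c u ℕ.≟ c w
      ... | no cu≢cw  = extend-distinct cu≢cw F<q
      ... | yes cu≡cw = extend-avoiding F []
        (subst (λ l → 1 + l < q) (sym (trans (length-++ (sat u)) (cong (λ m → length (sat u) + m) (length-map c (N (H − v) w))))) F′<q)
        small
        λ α∉F → (λ vx → case uw-nbrs vx of λ where
                   (inj₁ refl) → (λ cu≡α → α∉F (here (sym cu≡α))) , (λ α∈ → α∉F (there (∈-++⁺ˡ α∈)))
                   (inj₂ refl) → (λ cw≡α → α∉F (here (trans (sym cw≡α) (sym cu≡cw)))) ,
                                 (λ α∈ → around-w α∉F (∈-deduplicate⁻ ℕ._≟_ (map c (N (H − v) w))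
                                           (proj₁ (∈-filter⁻ (λ i → k ℕ.≤? suc (count c i (N (H − v) w)))
                                                    {xs = deduplicate ℕ._≟_ (map c (N (H − v) w))} α∈))))) ,
                (λ ()) ,
                λ vx vy x≢y _ xx′ yy′ cx′≡α cy′≡α → case uw-nbrs vx , uw-nbrs vy of λ where
                  (inj₁ refl , inj₁ refl) → x≢y refl
                  (inj₁ refl , inj₂ refl) → around-w α∉F (subst (_∈ _) cy′≡α (∈-map⁺ c (∈N⁺ (H − v) yy′)))
                  (inj₂ refl , _)         → around-w α∉F (subst (_∈ _) cx′≡α (∈-map⁺ c (∈N⁺ (H − v) xx′)))
        where
        -- The common colour of `u` and `w` is listed once. Colours saturated at `w` occur around
        -- `w`, so the last block covers them together with the colours that could close a cycle.
        F : List ℕ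
        F = c u ∷ sat u ++ map c (N (H − v) w)
        around-w : ∀ {α} → α ∉ F → α ∉ map c (N (H − v) w)
        around-w α∉F α∈ = α∉F (there (∈-++⁺ʳ (sat u) α∈))

-- Reducible configurations

record Thread (H : Graph n) (y v u : Fin n) : Set where
  field
    yv   : Adj H y v
    vu   : Adj H v u
    only : ∀ {x} → Adj H v x → x ≡ y ⊎ x ≡ u
    y≢u  : y ≢ u

∈pair : ∀ {x a b : A} → x ∈ a ∷ b ∷ [] → x ≡ a ⊎ x ≡ b
∈pair (here x≡a)         = inj₁ x≡a
∈pair (there (here x≡b)) = inj₂ x≡b

Thread-sym : ∀ {H : Graph n} {y v u} → Thread H y v u → Thread H u v y
Thread-sym {H = H} th = record
  { yv = Graph.sym H (Thread.vu th) ; vu = Graph.sym H (Thread.yv th)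
  ; only = Sum.swap ∘ Thread.only th ; y≢u = Thread.y≢u th ∘ sym }

degree-2⇒pair : ∀ {H : Graph n} {v} → degree H v ≡ 2 → ∃₂ λ a b → N H v ≡ a ∷ b ∷ [] × Thread H a v b
degree-2⇒pair {H = H} {v} deg≡2 = pair (N H v) refl deg≡2
  where
  pair : ∀ xs → N H v ≡ xs → length xs ≡ 2 → ∃₂ λ a b → N H v ≡ a ∷ b ∷ [] × Thread H a v b
  pair (a ∷ b ∷ []) eq refl = a , b , eq , record
    { yv   = Graph.sym H (∈N⁻ H (subst (a ∈_) (sym eq) (here refl)))
    ; vu   = ∈N⁻ H (subst (b ∈_) (sym eq) (there (here refl)))
    ; only = λ {x} vx → ∈pair (subst (x ∈_) eq (∈N⁺ H vx))
    ; y≢u  = case subst Unique eq (N! H v) of λ { ((a≢b ∷ []) ∷ _) → a≢b }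
    }

degree-2⇒Thread : ∀ {H : Graph n} {y v} → Adj H y v → degree H v ≡ 2 → ∃ (Thread H y v)
degree-2⇒Thread {H = H} yv deg≡2 with degree-2⇒pair {H = H} deg≡2
... | a , b , _ , th with Thread.only th (Graph.sym H yv)
...   | inj₁ refl = b , th
...   | inj₂ refl = a , Thread-sym th

deleteAll : Graph n → List (Fin n) → Graph n
deleteAll H []       = H
deleteAll H (v ∷ vs) = deleteAll (H − v) vs

deleteAll-⊑ : ∀ {H : Graph n} vs → deleteAll H vs ⊑ H
deleteAll-⊑ []                 = ⊑-refl
deleteAll-⊑ {H = H} (v ∷ vs) = ⊑-trans (deleteAll-⊑ vs) (−⊑ {H = H})

Adj-deleteAll⁺ : ∀ {H : Graph n} vs {x y} → Adj H x y → x ∉ vs → y ∉ vs → Adj (deleteAll H vs) x y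
Adj-deleteAll⁺ []               xy _   _   = xy
Adj-deleteAll⁺ {H = H} (v ∷ vs) xy x∉ y∉ =
  Adj-deleteAll⁺ vs (Adj-−⁺ {H = H} xy (x∉ ∘ here) (y∉ ∘ here)) (x∉ ∘ there) (y∉ ∘ there)

Adj-deleteAll⁻ : ∀ {H : Graph n} vs {x y} → Adj (deleteAll H vs) x y → y ∉ vs
Adj-deleteAll⁻ {H = H} (v ∷ vs) xy (here refl) = proj₂ (proj₂ (Adj-−⁻ {H = H} (_⊑_.Adj⊆Adj (deleteAll-⊑ vs) xy))) refl
Adj-deleteAll⁻         (v ∷ vs) xy (there y∈)  = Adj-deleteAll⁻ vs xy y∈

V-deleteAll⁺ : ∀ {H : Graph n} vs {x} → x ∈ˢ V H → x ∉ vs → x ∈ˢ V (deleteAll H vs)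
V-deleteAll⁺ []               x∈V _  = x∈V
V-deleteAll⁺ {H = H} (v ∷ vs) x∈V x∉ = V-deleteAll⁺ vs (V-−⁺ {H = H} x∈V (x∉ ∘ here)) (x∉ ∘ there)

order-mono : ∀ {F H : Graph n} → F ⊑ H → order F ≤ order H
order-mono F⊑H = Subsetₚ.p⊆q⇒∣p∣≤∣q∣ (_⊑_.V⊆V F⊑H)

-- A far end of degree 2 might itself be one of the neighbours of `y` that are to be deleted. A far
-- end of degree at most 2 is therefore singled out, to be reduced as a single thread; otherwise
-- every far end survives the deletion.
far-ends : ∀ {H : Graph n} {y} vs → (∀ {v} → v ∈ vs → Adj H y v × degree H v ≡ 2) →
  (∃₂ λ v u → Thread H y v u × degree H u ≤ 2) ⊎
  (∃ λ ps → map proj₁ ps ≡ vs × ∀ {v u} → (v , u) ∈ ps → Thread H y v u × 2 < degree H u)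
far-ends [] _ = inj₂ ([] , refl , λ ())
far-ends {H = H} (v ∷ vs) two with far-ends {H = H} vs (two ∘ there) | degree-2⇒Thread {H = H} (proj₁ (two (here refl))) (proj₂ (two (here refl)))
... | inj₁ found         | _ = inj₁ found
... | inj₂ (ps , refl , ths) | u , th with degree H u ℕ.≤? 2
...   | yes deg≤2 = inj₁ (v , u , th , deg≤2)
...   | no deg≰2  = inj₂ ((v , u) ∷ ps , refl , λ { (here refl) → th , ≰⇒> deg≰2 ; (there p∈) → ths p∈ })

module _ {k t q : ℕ} {L : ListAssignment n} (k≥4 : k ≥ 4) where

  private
    3≤k∸1 : 3 ≤ k ∸ 1
    3≤k∸1 = ∸-monoˡ-≤ 1 k≥4

  reduce-leaf : ∀ {H v} → Admissible k t q L H → v ∈ˢ V H → t < q → degree H v ≤ 1 →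
                Colourable k L (H − v) → Colourable k L H
  reduce-leaf {H} {v} adm v∈V t<q deg≤1 (c , good) = leaf (N H v) deg≤1 (∈N⁺ H) (∈N⁻ H)
    where
    leaf : ∀ xs → length xs ≤ 1 → (∀ {x} → Adj H v x → x ∈ xs) → (∀ {x} → x ∈ xs → Adj H v x) → Colourable k L H
    leaf [] _ nbr⁺ _ = let c′ , good′ , _ = extend-isolated k≥4 adm v∈V good [] (≤-<-trans z≤n t<q) (λ vx → case nbr⁺ vx of λ ())
                       in c′ , good′
    leaf (u ∷ []) _ nbr⁺ nbr⁻ =
      let c′ , good′ , _ = extend-leaf k≥4 adm v∈V good [] (subst (_< q) (sym (+-identityʳ t)) t<q) (nbr⁻ (here refl))
                             (λ vx → case nbr⁺ vx of λ { (here x≡u) → x≡u })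
      in c′ , good′
    leaf (_ ∷ _ ∷ _) (s≤s ())

  -- Without `v` the end `w` has fewer than `d ≤ 3 ≤ k ∸ 1` neighbours, hence no saturated colour,
  -- and `u` has at most `m ∸ 1` of them. Ends of different colours thus forbid at most 2 + (m ∸ 1)
  -- colours, ends of equal colour at most 1 + (m ∸ 1) + (d ∸ 1); both are less than `m + d`.
  reduce-thread : ∀ {H w v u} m d → Admissible k t q L H → Thread H w v u →
                  degree H u ≤ m * (k ∸ 1) → degree H w ≤ d → 2 ≤ d → d ≤ 3 → m + d ≤ q →
                  Colourable k L (H − v) → Colourable k L H
  reduce-thread {H} {w} {v} {u} m d adm th deg-u deg-w 2≤d d≤3 m+d≤q (c , good) =
    let c′ , good′ , _ = extend-thread k≥4 adm (Adj⇒∈V H vu) good (Sum.swap ∘ only) distinct-cost equal-cost in c′ , good′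
    where
    open Thread th
    open ≤-Reasoning
    su sw : ℕ
    su = length (saturated k c (H − v) u)
    sw = length (saturated k c (H − v) w)
    deg-w′ : degree (H − v) w < d
    deg-w′ = <-≤-trans (degree-− {H = H} yv) deg-w
    su<m : su < m
    su<m = ∣saturated∣< {H = H − v} {u} m (<-≤-trans (degree-− {H = H} (Graph.sym H vu)) deg-u)
    sw<1 : sw < 1
    sw<1 = ∣saturated∣< {H = H − v} {w} 1
      (<-≤-trans deg-w′ (≤-trans d≤3 (≤-trans 3≤k∸1 (≤-reflexive (sym (*-identityˡ _))))))
    distinct-cost : 2 + (su + sw) < q
    distinct-cost = begin-strict
      2 + (su + sw)  ≤⟨ +-monoʳ-≤ 2 (+-monoʳ-≤ su (ℕ.s≤s⁻¹ sw<1)) ⟩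
      2 + (su + 0)   ≡⟨ cong (λ z → 2 + z) (+-identityʳ su) ⟩
      2 + su         ≡⟨ +-comm 2 su ⟩
      su + 2         <⟨ +-mono-<-≤ su<m 2≤d ⟩
      m + d          ≤⟨ m+d≤q ⟩
      q              ∎
    equal-cost : 1 + (su + degree (H − v) w) < q
    equal-cost = begin-strict
      suc su + degree (H − v) w  ≤⟨ +-monoˡ-≤ _ su<m ⟩
      m + degree (H − v) w       <⟨ +-monoʳ-< m deg-w′ ⟩
      m + d                      ≤⟨ m+d≤q ⟩
      q                          ∎

  -- While some neighbour of `y` is uncoloured, at most `σ` colours are saturated at `y`. Each
  -- middle vertex then avoids the two different colours of its ends, at most `t ∸ 1` saturated
  -- colours at the far end and `σ` at `y`, which makes `suc t + σ`. Filling the other threads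
  -- leaves the colours of `y` and of the far ends unchanged.
  extend-threads : ∀ (ps : List (Fin n × Fin n)) {H c y} σ → Admissible k t q L H →
    degree H y ≤ suc σ * (k ∸ 1) → suc t + σ < q →
    (∀ {v u} → (v , u) ∈ ps → Thread H y v u × u ∉ map proj₁ ps × c y ≢ c u) → Unique (map proj₁ ps) →
    IsCoreFreeColoring k L (deleteAll H (map proj₁ ps)) c →
    ∃ λ c′ → IsCoreFreeColoring k L H c′ × (∀ x → x ∉ map proj₁ ps → c′ x ≡ c x)
  extend-threads [] σ adm deg-y cost ths vs! good = _ , good , λ _ _ → refl
  extend-threads ((v , u) ∷ ps) {H} {c} {y} σ adm deg-y cost ths (v∉vs ∷ vs!) good =
    case extend-threads ps {H − v} σ (Admissible-⊑ (−⊑ {H = H}) adm)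
           (≤-trans (degree-mono (−⊑ {H = H}) y) deg-y) cost ths′ vs! good of λ { (c₁ , good₁ , same₁) →
    case extend-distinct k≥4 adm (Adj⇒∈V H vu) good₁ (Sum.swap ∘ only)
           (λ eq → cy≢cu (trans (sym (same₁ y y∉vs)) (trans (sym eq) (same₁ u (u∉ ∘ there)))))
           (cost₁ c₁) of λ { (c₂ , good₂ , same₂ , _) →
    c₂ , good₂ , λ x x∉ → trans (same₂ (x∉ ∘ here)) (same₁ x (x∉ ∘ there)) }}
    where
    th = proj₁ (ths (here refl))
    u∉ = proj₁ (proj₂ (ths (here refl)))
    cy≢cu = proj₂ (proj₂ (ths (here refl)))
    open Thread th
    y≢nbr : ∀ {x} → Adj H y x → y ≢ x
    y≢nbr yx y≡x = irrefl H y≡x yx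
    y∉vs : y ∉ map proj₁ ps
    y∉vs y∈ with (v′ , u′) , p∈ , refl ← ∈-map⁻ proj₁ y∈ = y≢nbr (Thread.yv (proj₁ (ths (there p∈)))) refl
    ths′ : ∀ {v′ u′} → (v′ , u′) ∈ ps → Thread (H − v) y v′ u′ × u′ ∉ map proj₁ ps × c y ≢ c u′
    ths′ {v′} {u′} p∈ with th′ , u′∉ , cy≢cu′ ← ths (there p∈) =
      record { yv   = Adj-−⁺ {H = H} (Thread.yv th′) (y≢nbr yv) v′≢v
             ; vu   = Adj-−⁺ {H = H} (Thread.vu th′) v′≢v (u′∉ ∘ here)
             ; only = Thread.only th′ ∘ proj₁
             ; y≢u  = Thread.y≢u th′ } , u′∉ ∘ there , cy≢cu′
      where
      v′≢v : v′ ≢ v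
      v′≢v refl = All.lookup v∉vs (∈-map⁺ proj₁ p∈) refl
    cost₁ : ∀ c₁ → 2 + (length (saturated k c₁ (H − v) u) + length (saturated k c₁ (H − v) y)) < q
    cost₁ c₁ = ≤-<-trans (s≤s (+-mono-≤
      (∣saturated∣< {H = H − v} {u} t (<-≤-trans (degree-− {H = H} (Graph.sym H vu)) (Admissible.degree-bound adm u)))
      (ℕ.s≤s⁻¹ (∣saturated∣< {H = H − v} {y} (suc σ) (<-≤-trans (degree-− {H = H} yv) deg-y))))) cost

  -- The cost of colouring a centre whose only coloured neighbours are those in `W`: it avoids `l`
  -- colours of far ends, and up to `t` more if `W` has a member.
  data Cheap (l : ℕ) : List (Fin n) → Set where
    none : l < q → Cheap l []
    one  : ∀ {w} → t + l < q → Cheap l (w ∷ [])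

  -- y is coloured first and must avoid the far ends of all its threads but one;
  -- the exceptional thread is then filled while y has at most one coloured
  -- neighbour, so a repeated colour at its two ends does no harm.
  reduce-star : ∀ {H y W v₀ u₀} ps σ → let vs = v₀ ∷ map proj₁ ps in
    Admissible k t q L H → y ∈ˢ V H → degree H y ≤ suc σ * (k ∸ 1) → suc t + σ < q →
    Cheap (length ps) W → (∀ {w} → w ∈ W → Adj H y w × w ∉ vs) → (∀ {x} → Adj H y x → x ∈ W ⊎ x ∈ vs) →
    (∀ {v u} → (v , u) ∈ (v₀ , u₀) ∷ ps → Thread H y v u × u ∉ vs) → Unique vs →
    Colourable k L (deleteAll H (map proj₁ ps) − v₀ − y) → Colourable k L H
  reduce-star {H} {y} {W} {v₀} {u₀} ps σ adm y∈V deg-y cost cheap W-nbrs nbrs ths (v₀∉vs ∷ vs!) (c , good) =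
    case colour-y W cheap (proj₁ ∘ W-nbrs) (proj₂ ∘ W-nbrs) y-nbrs of λ { (c₁ , good₁ , same₁ , fresh₁) →
    case extend-thread k≥4 adm₁ (V-deleteAll⁺ vs (Adj⇒∈V H vu) v₀∉) good₁
           (Sum.swap ∘ only ∘ _⊑_.Adj⊆Adj H₁⊑H) (cost₁ c₁) (cost₁′ c₁) of λ { (c₂ , good₂ , same₂ , _) →
    case extend-threads ps σ adm deg-y cost
           (λ {v} {u} p∈ → let th , u∉ = ths (there p∈) in th , u∉ ∘ there ,
             λ eq → fresh₁ (subst (_∈ map (c ∘ proj₂) ps)
               (sym (trans (sym (same₂ y≢v₀)) (trans eq (trans (same₂ (λ { refl → u∉ (here refl) })) (same₁ (Thread.y≢u th ∘ sym))))))
               (∈-map⁺ (c ∘ proj₂) p∈)))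
           vs! good₂ of λ { (c₃ , good₃ , _) →
    c₃ , good₃ }}}
    where
    open Thread (proj₁ (ths (here refl)))
    vs = map proj₁ ps
    H₁ = deleteAll H vs
    H₁⊑H : H₁ ⊑ H
    H₁⊑H = deleteAll-⊑ vs
    adm₁ : Admissible k t q L H₁
    adm₁ = Admissible-⊑ H₁⊑H adm
    y≢v₀ : y ≢ v₀
    y≢v₀ y≡v₀ = irrefl H y≡v₀ yv
    v₀∉ : v₀ ∉ vs
    v₀∉ v₀∈ = All.lookup v₀∉vs v₀∈ refl
    y∉ : y ∉ vs
    y∉ y∈ with p , p∈ , refl ← ∈-map⁻ proj₁ y∈ = irrefl H refl (Thread.yv (proj₁ (ths (there p∈))))
    y-nbrs : ∀ {x} → Adj (H₁ − v₀) y x → x ∈ W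
    y-nbrs yx with yx₁ , _ , x≢v₀ ← Adj-−⁻ {H = H₁} yx = case nbrs (_⊑_.Adj⊆Adj H₁⊑H yx₁) of λ where
      (inj₁ x∈W)         → x∈W
      (inj₂ (here x≡v₀)) → contradiction x≡v₀ x≢v₀
      (inj₂ (there x∈))  → contradiction x∈ (Adj-deleteAll⁻ vs yx₁)
    -- The colour of `u₀` is left out. When degree 3 (for lists of size `2 + t`) or degree 4 (for
    -- lists of size `3 + t`) occurs with one neighbour in `W`, including it would raise the
    -- estimate to `q`.
    E = map (c ∘ proj₂) ps
    adm₂ : Admissible k t q L (H₁ − v₀)
    adm₂ = Admissible-⊑ (−⊑ {H = H₁}) adm₁
    y∈V₂ : y ∈ˢ V (H₁ − v₀)
    y∈V₂ = V-−⁺ {H = H₁} (V-deleteAll⁺ vs y∈V y∉) y≢v₀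
    colour-y : ∀ W → Cheap (length ps) W → (∀ {w} → w ∈ W → Adj H y w) → (∀ {w} → w ∈ W → w ∉ v₀ ∷ vs) →
               (∀ {x} → Adj (H₁ − v₀) y x → x ∈ W) → Extension k L (H₁ − v₀) y c E
    colour-y [] (none l<q) _ _ nbr = extend-isolated k≥4 adm₂ y∈V₂ good E
      (subst (_< q) (sym (length-map (c ∘ proj₂) ps)) l<q) (λ yx → case nbr yx of λ ())
    colour-y (w ∷ []) (one t+l<q) yw w∉ nbr = extend-leaf k≥4 adm₂ y∈V₂ good E
      (subst (λ l → t + l < q) (sym (length-map (c ∘ proj₂) ps)) t+l<q)
      (Adj-−⁺ {H = H₁} (Adj-deleteAll⁺ vs (yw (here refl)) y∉ (w∉ (here refl) ∘ there)) y≢v₀ (w∉ (here refl) ∘ here))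
      (λ yx → case nbr yx of λ { (here x≡w) → x≡w })
    ∣W∣≤1 : ∀ {l W} → Cheap l W → length W ≤ 1
    ∣W∣≤1 (none _) = z≤n
    ∣W∣≤1 (one _)  = ≤-refl
    deg-y₂ : degree (H₁ − v₀) y ≤ 1
    deg-y₂ = ≤-trans (degree≤ (H₁ − v₀) y-nbrs) (∣W∣≤1 cheap)
    2+t≤q : 2 + t ≤ q
    2+t≤q = ≤-trans (s≤s (m≤m+n (suc t) σ)) cost
    module _ (c₁ : Coloring n) where
      su sy : ℕ
      su = length (saturated k c₁ (H₁ − v₀) u₀)
      sy = length (saturated k c₁ (H₁ − v₀) y)
      su<t : su < t
      su<t = ∣saturated∣< {H = H₁ − v₀} {u₀} t (<-≤-trans
        (degree-− {H = H₁} (Graph.sym H₁ (Adj-deleteAll⁺ vs vu v₀∉ (proj₂ (ths (here refl)) ∘ there))))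
        (Admissible.degree-bound adm₁ u₀))
      -- At this stage `y` has at most one coloured neighbour, fewer than `k ∸ 1`.
      sy<1 : sy < 1
      sy<1 = ∣saturated∣< {H = H₁ − v₀} {y} 1
        (≤-<-trans deg-y₂ (≤-trans (s≤s (s≤s z≤n)) (≤-trans 3≤k∸1 (≤-reflexive (sym (*-identityˡ _))))))
      open ≤-Reasoning
      cost₁ : 2 + (su + sy) < q
      cost₁ = begin-strict
        2 + (su + sy)  ≤⟨ +-monoʳ-≤ 2 (+-monoʳ-≤ su (ℕ.s≤s⁻¹ sy<1)) ⟩
        2 + (su + 0)   ≡⟨ cong (λ z → 2 + z) (+-identityʳ su) ⟩
        2 + su         <⟨ +-monoʳ-< 2 su<t ⟩
        2 + t          ≤⟨ 2+t≤q ⟩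
        q              ∎
      cost₁′ : 1 + (su + degree (H₁ − v₀) y) < q
      cost₁′ = begin-strict
        1 + (su + degree (H₁ − v₀) y)  ≤⟨ +-monoʳ-≤ 1 (+-monoʳ-≤ su deg-y₂) ⟩
        1 + (su + 1)                   ≡⟨ cong suc (+-comm su 1) ⟩
        2 + su                         <⟨ +-monoʳ-< 2 su<t ⟩
        2 + t                          ≤⟨ 2+t≤q ⟩
        q                              ∎

  -- The star at `y` with `W` the neighbours of degree other than 2. As `ps` omits one thread, the
  -- degree of `y` is `1 + length ps` or `2 + length ps`, and the hypotheses on these two cases are
  -- the costs `length ps < q` and `t + length ps < q` of `Cheap`.
  reduce-centre : ∀ {H y} σ → Admissible k t q L H → y ∈ˢ V H → degree H y ≤ suc σ * (k ∸ 1) → suc t + σ < q →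
    (degree H y ≡ count (degree H) 2 (N H y) → degree H y ≤ q) →
    (degree H y ≡ suc (count (degree H) 2 (N H y)) → t + degree H y < 2 + q) →
    degree H y ≤ suc (count (degree H) 2 (N H y)) → 0 < count (degree H) 2 (N H y) →
    (∀ F → F ⊑ H → order F < order H → Colourable k L F) → Colourable k L H
  reduce-centre {H} {y} σ adm y∈V deg-y cost all-two one-other few-others some-two smaller
    with far-ends {H = H} {y} (filter (λ x → degree H x ℕ.≟ 2) (N H y))
           (λ v∈ → let v∈N , deg≡2 = ∈-filter⁻ (λ x → degree H x ℕ.≟ 2) {xs = N H y} v∈ in ∈N⁻ H v∈N , deg≡2)
  ... | inj₁ (v , u , th , deg-u≤2) =
    reduce-thread t 2 adm (Thread-sym th) (Admissible.degree-bound adm y) deg-u≤2 ≤-refl (s≤s (s≤s z≤n))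
      (≤-trans (≤-reflexive (+-comm t 2)) (≤-trans (s≤s (m≤m+n (suc t) σ)) cost))
      (smaller (H − v) (−⊑ {H = H}) (order-− {H = H} (Adj⇒∈V H (Thread.vu th))))
  ... | inj₂ ([] , eq , _) = contradiction some-two (subst (λ vs → ¬ 0 < length vs) eq λ ())
  ... | inj₂ ((v₀ , u₀) ∷ ps , eq , ths) =
    reduce-star ps σ adm y∈V deg-y cost (cheap others ∣others∣)
      (λ w∈ → let w∈N , ≢2 = ∈-filter⁻ other? {xs = N H y} w∈ in ∈N⁻ H w∈N ,
              λ w∈vs → ≢2 (degree-two w∈vs))
      split
      (λ p∈ → proj₁ (ths p∈) , λ u∈vs → contradiction (degree-two u∈vs) (<⇒≢ (proj₂ (ths p∈)) ∘ sym))
      (subst Unique (sym eq) (Uniqueₚ.filter⁺ two? (N! H y)))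
      (smaller _ (⊑-trans (−⊑ {H = H₂}) H₂⊑H) (<-≤-trans (order-− {H = H₂} y∈V₂) (order-mono H₂⊑H)))
    where
    vs = v₀ ∷ map proj₁ ps
    H₁ = deleteAll H (map proj₁ ps)
    H₂ = H₁ − v₀
    H₂⊑H : H₂ ⊑ H
    H₂⊑H = ⊑-trans (−⊑ {H = H₁}) (deleteAll-⊑ (map proj₁ ps))
    two? : ∀ x → Dec (degree H x ≡ 2)
    two? x = degree H x ℕ.≟ 2
    other? : ∀ x → Dec (¬ degree H x ≡ 2)
    other? x = ¬? (two? x)
    others : List (Fin n)
    others = filter other? (N H y)
    degree-two : ∀ {x} → x ∈ vs → degree H x ≡ 2
    degree-two x∈ = proj₂ (∈-filter⁻ two? {xs = N H y} (subst (_ ∈_) eq x∈))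
    y∉vs : y ∉ vs
    y∉vs y∈ with p , p∈ , refl ← ∈-map⁻ proj₁ {xs = (v₀ , u₀) ∷ ps} y∈ = irrefl H refl (Thread.yv (proj₁ (ths p∈)))
    y∈V₂ : y ∈ˢ V H₂
    y∈V₂ = V-−⁺ {H = H₁} (V-deleteAll⁺ (map proj₁ ps) y∈V (y∉vs ∘ there)) (y∉vs ∘ here)
    split : ∀ {x} → Adj H y x → x ∈ others ⊎ x ∈ vs
    split {x} yx = case two? x of λ where
      (yes ≡2) → inj₂ (subst (x ∈_) (sym eq) (∈-filter⁺ two? (∈N⁺ H yx) ≡2))
      (no ≢2)  → inj₁ (∈-filter⁺ other? (∈N⁺ H yx) ≢2)
    ∣vs∣ : count (degree H) 2 (N H y) ≡ suc (length ps)
    ∣vs∣ = trans (cong length (sym eq)) (cong suc (length-map proj₁ ps))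
    ∣others∣ : degree H y ≡ suc (length ps) + length others
    ∣others∣ = trans (length≡count+others (degree H) 2 (N H y)) (cong (λ m → m + length others) ∣vs∣)
    cheap : ∀ W → degree H y ≡ suc (length ps) + length W → Cheap (length ps) W
    cheap [] deg = none (subst (_≤ q) deg′ (all-two (trans deg′ (sym ∣vs∣))))
      where deg′ = trans deg (+-identityʳ _)
    cheap (w ∷ []) deg = one (ℕ.s≤s⁻¹ (ℕ.s≤s⁻¹ (subst (_< 2 + q)
        (trans (cong (λ m → t + m) deg′) (trans (+-suc t _) (cong suc (+-suc t _)))) (one-other (trans deg′ (cong suc (sym ∣vs∣)))))))
      where deg′ = trans deg (+-comm (suc (length ps)) 1)
    cheap (w ∷ w′ ∷ W) deg = contradiction few-others (<⇒≱ (begin-strict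
      suc (count (degree H) 2 (N H y))    ≡⟨ cong suc ∣vs∣ ⟩
      2 + length ps                       <⟨ s≤s (s≤s (s≤s (m≤m+n (length ps) (length W)))) ⟩
      3 + (length ps + length W)          ≡⟨ cong (λ m → 2 + m) (+-suc (length ps) (length W)) ⟨
      2 + (length ps + (1 + length W))    ≡⟨ cong suc (+-suc (length ps) (1 + length W)) ⟨
      suc (length ps) + (2 + length W)    ≡⟨ deg ⟨
      degree H y                          ∎))
      where open ≤-Reasoning

-- Discharging

𝟙 : ∀ {P : Set} → Dec P → ℕ
𝟙 d = if does d then 1 else 0

𝟙-true : ∀ {P : Set} (d : Dec P) → P → 𝟙 d ≡ 1
𝟙-true d p rewrite dec-true d p = refl

𝟙-false : ∀ {P : Set} (d : Dec P) → ¬ P → 𝟙 d ≡ 0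
𝟙-false d ¬p rewrite dec-false d ¬p = refl

𝟙-cong : ∀ {P Q : Set} (d : Dec P) (e : Dec Q) → (P → Q) → (Q → P) → 𝟙 d ≡ 𝟙 e
𝟙-cong (yes p) e P⇒Q Q⇒P = sym (𝟙-true e (P⇒Q p))
𝟙-cong (no ¬p) e P⇒Q Q⇒P = sym (𝟙-false e (¬p ∘ Q⇒P))

sumOver : (A → ℕ) → List A → ℕ
sumOver f xs = ListAction.sum (map f xs)

length-filter≡sumOver : ∀ {P : A → Set} (P? : ∀ x → Dec (P x)) xs → length (filter P? xs) ≡ sumOver (𝟙 ∘ P?) xs
length-filter≡sumOver P? [] = refl
length-filter≡sumOver P? (x ∷ xs) with does (P? x)
... | true  = cong suc (length-filter≡sumOver P? xs)
... | false = length-filter≡sumOver P? xs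

length-filter-tabulate : ∀ {m} {P : A → Set} (P? : ∀ x → Dec (P x)) (f : Fin m → A) →
                         length (filter P? (tabulate f)) ≡ sum (λ i → 𝟙 (P? (f i)))
length-filter-tabulate {m = zero}  P? f = refl
length-filter-tabulate {m = suc m} P? f with does (P? (f zero))
... | true  = cong suc (length-filter-tabulate P? (f ∘ suc))
... | false = length-filter-tabulate P? (f ∘ suc)

sumOver-filter-tabulate : ∀ {m} {P : A → Set} (P? : ∀ x → Dec (P x)) (g : A → ℕ) (f : Fin m → A) →
                          sumOver g (filter P? (tabulate f)) ≡ sum (λ i → 𝟙 (P? (f i)) * g (f i))
sumOver-filter-tabulate {m = zero}  P? g f = refl
sumOver-filter-tabulate {m = suc m} P? g f with does (P? (f zero))
... | true  = cong₂ _+_ (sym (*-identityˡ (g (f zero)))) (sumOver-filter-tabulate P? g (f ∘ suc))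
... | false = sumOver-filter-tabulate P? g (f ∘ suc)

length-filter-cartesianProduct : ∀ {B : Set} {m l} {P : A × B → Set} (P? : ∀ x → Dec (P x)) (f : Fin m → A) (h : Fin l → B) →
  length (filter P? (cartesianProduct (tabulate f) (tabulate h))) ≡ sum (λ i → sum (λ j → 𝟙 (P? (f i , h j))))
length-filter-cartesianProduct {m = zero}  P? f h = refl
length-filter-cartesianProduct {m = suc m} P? f h = begin
  length (filter P? (row ++ rest))                    ≡⟨ cong length (filter-++ P? row rest) ⟩
  length (filter P? row ++ filter P? rest)            ≡⟨ length-++ (filter P? row) ⟩
  length (filter P? row) + length (filter P? rest)    ≡⟨ cong₂ _+_ first-row (length-filter-cartesianProduct P? (f ∘ suc) h) ⟩
  sum (λ i → sum (λ j → 𝟙 (P? (f i , h j))))          ∎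
  where
  open ≡-Reasoning
  row rest : List _
  row  = map (f zero ,_) (tabulate h)
  rest = cartesianProduct (tabulate (f ∘ suc)) (tabulate h)
  first-row : length (filter P? row) ≡ sum (λ j → 𝟙 (P? (f zero , h j)))
  first-row = trans (cong (length ∘ filter P?) (map-tabulate h (f zero ,_)))
                    (length-filter-tabulate P? (λ j → f zero , h j))

∣p∣≡sum : ∀ {m} (p : Subset m) → ∣ p ∣ ≡ sum (λ i → 𝟙 (i Subsetₚ.∈? p))
∣p∣≡sum []          = refl
∣p∣≡sum (true ∷ p)  = cong suc (∣p∣≡sum p)
∣p∣≡sum (false ∷ p) = ∣p∣≡sum p

sum<sum⇒∃< : ∀ {m} (f g : Fin m → ℕ) → sum f < sum g → ∃ λ i → f i < g i
sum<sum⇒∃< {zero}  f g ()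
sum<sum⇒∃< {suc m} f g lt with f zero ℕ.<? g zero
... | yes f₀<g₀ = zero , f₀<g₀
... | no f₀≮g₀ = let i , fi<gi = sum<sum⇒∃< (f ∘ suc) (g ∘ suc)
                                   (+-cancelˡ-< (f zero) _ _ (<-≤-trans lt (+-monoˡ-≤ _ (≮⇒≥ f₀≮g₀))))
                 in suc i , fi<gi

module _ (H : Graph n) where

  private
    adj : Fin n → Fin n → ℕ
    adj v u = 𝟙 (adj? H v u)

    adj-sym : ∀ v u → adj v u ≡ adj u v
    adj-sym v u = 𝟙-cong (adj? H v u) (adj? H u v) (Graph.sym H) (Graph.sym H)

    edge? : ∀ e → Dec (proj₁ e Fin.< proj₂ e × Adj H (proj₁ e) (proj₂ e))
    edge? e = (proj₁ e Fin.<? proj₂ e) ×-dec adj? H (proj₁ e) (proj₂ e)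

    edge : Fin n → Fin n → ℕ
    edge v u = 𝟙 (edge? (v , u))

    adj≡edge+edge : ∀ v u → adj v u ≡ edge v u + edge u v
    adj≡edge+edge v u = case Finₚ.<-cmp v u of λ where
        (tri< v<u _ u≮v) → trans (sym (+-identityʳ _)) (cong₂ _+_
          (𝟙-cong (adj? H v u) (edge? (v , u)) (v<u ,_) proj₂) (sym (𝟙-false (edge? (u , v)) (u≮v ∘ proj₁))))
        (tri≈ _ refl _) → trans (𝟙-false (adj? H v v) (irrefl H refl))
          (sym (cong₂ _+_ no-loop no-loop))
        (tri> v≮u _ u<v) → cong₂ _+_ (sym (𝟙-false (edge? (v , u)) (v≮u ∘ proj₁)))
          (𝟙-cong (adj? H v u) (edge? (u , v)) (λ vu → u<v , Graph.sym H vu) (Graph.sym H ∘ proj₂))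
      where
      no-loop : edge v v ≡ 0
      no-loop = 𝟙-false (edge? (v , v)) (irrefl H refl ∘ proj₂)

  degree≡sum : ∀ v → degree H v ≡ sum (adj v)
  degree≡sum v = length-filter-tabulate (adj? H v) id

  handshake : sum (degree H) ≡ 2 * size H
  handshake = begin
    sum (degree H)                                               ≡⟨ sum-cong-≗ degree≡sum ⟩
    sum (λ v → sum (adj v))                                      ≡⟨ sum-cong-≗ (λ v →
                                                                  trans (sum-cong-≗ (adj≡edge+edge v))
                                                                        (∑-distrib-+ (edge v) (λ u → edge u v))) ⟩
    sum (λ v → sum (edge v) + sum (λ u → edge u v))              ≡⟨ ∑-distrib-+ (λ v → sum (edge v)) (λ v → sum (λ u → edge u v)) ⟩
    sum (λ v → sum (edge v)) + sum (λ v → sum (λ u → edge u v))  ≡⟨ cong₂ _+_ size≡ (trans (∑-comm (λ v u → edge u v)) size≡) ⟩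
    size H + size H                                              ≡⟨ cong (λ m → size H + m) (+-identityʳ (size H)) ⟨
    2 * size H                                                   ∎
    where
    open ≡-Reasoning
    size≡ : sum (λ v → sum (edge v)) ≡ size H
    size≡ = sym (length-filter-cartesianProduct edge? id id)

  module _ (g : ℕ → ℕ) where

    private
      γ τ received sent : Fin n → ℕ
      γ v = g (degree H v)
      τ v = 𝟙 (degree H v ℕ.≟ 2)
      received v = τ v * sumOver γ (N H v)
      sent v = γ v * count (degree H) 2 (N H v)

      received≡ : ∀ v → received v ≡ sum (λ u → τ v * (adj v u * γ u))
      received≡ v = trans (cong (λ m → τ v * m) (sumOver-filter-tabulate (adj? H v) γ id))
                          (*-distribˡ-sum (τ v) (λ u → adj v u * γ u))

      sent≡ : ∀ v → sent v ≡ sum (λ u → γ v * (adj v u * τ u))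
      sent≡ v = trans (cong (λ m → γ v * m) (trans (length-filter≡sumOver (λ u → degree H u ℕ.≟ 2) (N H v))
                                                  (sumOver-filter-tabulate (adj? H v) τ id)))
                      (*-distribˡ-sum (γ v) (λ u → adj v u * τ u))

      rotate : ∀ v u → τ v * (adj v u * γ u) ≡ γ u * (adj u v * τ v)
      rotate v u = begin
        τ v * (adj v u * γ u)  ≡⟨ *-assoc (τ v) (adj v u) (γ u) ⟨
        τ v * adj v u * γ u    ≡⟨ *-comm (τ v * adj v u) (γ u) ⟩
        γ u * (τ v * adj v u)  ≡⟨ cong (λ m → γ u * m) (trans (*-comm (τ v) (adj v u)) (cong (_* τ v) (adj-sym v u))) ⟩
        γ u * (adj u v * τ v)  ∎
        where open ≡-Reasoning

      -- Double counting of the adjacent pairs `v`, `u` with `v` of degree 2, weighted by the gift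
      -- of `u`.
      balance : sum received ≡ sum sent
      balance = begin
        sum received                                ≡⟨ sum-cong-≗ received≡ ⟩
        sum (λ v → sum (λ u → τ v * (adj v u * γ u)))  ≡⟨ sum-cong-≗ (λ v → sum-cong-≗ (rotate v)) ⟩
        sum (λ v → sum (λ u → γ u * (adj u v * τ v)))  ≡⟨ ∑-comm (λ v u → γ u * (adj u v * τ v)) ⟩
        sum (λ u → sum (λ v → γ u * (adj u v * τ v)))  ≡⟨ sum-cong-≗ sent≡ ⟨
        sum sent                                    ∎
        where open ≡-Reasoning

    -- Every vertex starts with charge s * degree and sends g (degree) to each
    -- neighbour of degree 2.
    discharging : ∀ s p → s * (2 * size H) < p * order H → ∃ λ v → v ∈ˢ V H ×
      s * degree H v + 𝟙 (degree H v ℕ.≟ 2) * sumOver (g ∘ degree H) (N H v) < p + g (degree H v) * count (degree H) 2 (N H v)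
    discharging s p s2e<pn with sum<sum⇒∃< (λ v → s * degree H v + received v) (λ v → p * 𝟙 (v Subsetₚ.∈? V H) + sent v) lt
      where
      open ≤-Reasoning
      lt : sum (λ v → s * degree H v + received v) < sum (λ v → p * 𝟙 (v Subsetₚ.∈? V H) + sent v)
      lt = begin-strict
        sum (λ v → s * degree H v + received v)          ≡⟨ ∑-distrib-+ (λ v → s * degree H v) received ⟩
        sum (λ v → s * degree H v) + sum received        ≡⟨ cong (_+ sum received) (*-distribˡ-sum s (degree H)) ⟨
        s * sum (degree H) + sum received                ≡⟨ cong (λ m → s * m + sum received) handshake ⟩
        s * (2 * size H) + sum received                  <⟨ +-monoˡ-< (sum received) s2e<pn ⟩
        p * order H + sum received                       ≡⟨ cong₂ (λ a b → p * a + b) (∣p∣≡sum (V H)) balance ⟩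
        p * sum (λ v → 𝟙 (v Subsetₚ.∈? V H)) + sum sent  ≡⟨ cong (_+ sum sent) (*-distribˡ-sum p (λ v → 𝟙 (v Subsetₚ.∈? V H))) ⟩
        sum (λ v → p * 𝟙 (v Subsetₚ.∈? V H)) + sum sent  ≡⟨ ∑-distrib-+ (λ v → p * 𝟙 (v Subsetₚ.∈? V H)) sent ⟨
        sum (λ v → p * 𝟙 (v Subsetₚ.∈? V H) + sent v)    ∎
    ... | v , below with v Subsetₚ.∈? V H
    ...   | yes v∈V = v , v∈V , <-≤-trans below (+-monoˡ-≤ (sent v) (≤-reflexive (*-identityʳ p)))
    -- Outside `V H` there is neither an allowance `p` nor a neighbour to send to, so the right-hand
    -- side is 0 and cannot exceed anything.
    ...   | no v∉V  = contradiction (subst (s * degree H v + received v <_)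
        (trans (cong₂ _+_ (*-zeroʳ p) (cong (λ m → γ v * m) isolated)) (*-zeroʳ (γ v))) below) λ ()
      where
      isolated : count (degree H) 2 (N H v) ≡ 0
      isolated = n≤0⇒n≡0 (≤-trans (length-filter (λ u → degree H u ℕ.≟ 2) (N H v))
                                  (degree≤ H {xs = []} λ vu → contradiction (Adj⇒∈V H vu) v∉V))

pattern 2+ m = suc (suc m)
pattern 3+ m = suc (2+ m)
pattern 4+ m = suc (3+ m)
pattern 5+ m = suc (4+ m)
pattern 6+ m = suc (5+ m)

-- The three parts use the charges (s , p) = (5 , 12), (3 , 8) and (2 , 6).
gift₁ gift₂ gift₃ : ℕ → ℕ
gift₁ (4+ _) = 2
gift₁ 3      = 1
gift₁ _      = 0
gift₂ (3+ _) = 1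
gift₂ _      = 0
gift₃ (4+ _) = 1
gift₃ _      = 0

-- Degree 3 can give 1 to every neighbour, as 15 ∸ 3 = 12, and degree `d ≥ 4` can give 2, as 5d ∸ 2d
-- = 3d ≥ 12. So only degrees up to 2 can end below 12.
poor-cases₁ : ∀ d S T → 5 * d + 𝟙 (d ℕ.≟ 2) * S < 12 + gift₁ d * T → T ≤ d → d ≤ 1 ⊎ (d ≡ 2 × S < 2)
poor-cases₁ 0 S T lt T≤d = inj₁ z≤n
poor-cases₁ 1 S T lt T≤d = inj₁ ≤-refl
poor-cases₁ 2 S T lt T≤d = inj₂ (refl , subst (_< 2) (+-identityʳ S) (+-cancelˡ-< 10 _ _ lt))
poor-cases₁ 3 S T lt T≤d = contradiction lt (≤⇒≯ (+-monoʳ-≤ 12 (≤-trans (≤-reflexive (*-identityˡ T)) T≤d)))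
poor-cases₁ (4+ e) S T lt T≤d = contradiction lt (≤⇒≯ (begin
  12 + 2 * T         ≤⟨ +-monoʳ-≤ 12 (*-monoʳ-≤ 2 T≤d) ⟩
  12 + 2 * (4 + e)   ≡⟨ solve 1 (λ e → con 12 :+ con 2 :* (con 4 :+ e) := con 20 :+ con 2 :* e) refl e ⟩
  20 + 2 * e         ≤⟨ +-monoʳ-≤ 20 (*-monoˡ-≤ e {2} {5} (s≤s (s≤s z≤n))) ⟩
  20 + 5 * e         ≡⟨ solve 1 (λ e → con 20 :+ con 5 :* e := con 5 :* (con 4 :+ e) :+ con 0) refl e ⟩
  5 * (4 + e) + 0    ∎))
  where open ≤-Reasoning; open +-*-Solver

-- Degree `d ≥ 4` keeps at least 3d ∸ d = 2d ≥ 8. Degree 3 has only one unit to spare and is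
-- overdrawn by two gifts.
poor-cases₂ : ∀ d S T → 3 * d + 𝟙 (d ℕ.≟ 2) * S < 8 + gift₂ d * T → T ≤ d →
        d ≤ 1 ⊎ (d ≡ 2 × S < 2) ⊎ (d ≡ 3 × 2 ≤ T)
poor-cases₂ 0 S T lt T≤d = inj₁ z≤n
poor-cases₂ 1 S T lt T≤d = inj₁ ≤-refl
poor-cases₂ 2 S T lt T≤d = inj₂ (inj₁ (refl , subst (_< 2) (+-identityʳ S) (+-cancelˡ-< 6 _ _ lt)))
poor-cases₂ 3 S T lt T≤d = inj₂ (inj₂ (refl , subst (2 ≤_) (*-identityˡ T) (+-cancelˡ-≤ 8 _ _ lt)))
poor-cases₂ (4+ e) S T lt T≤d = contradiction lt (≤⇒≯ (begin
  8 + 1 * T          ≤⟨ +-monoʳ-≤ 8 (≤-trans (≤-reflexive (*-identityˡ T)) T≤d) ⟩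
  12 + e             ≤⟨ +-monoʳ-≤ 12 (m≤m+n e (2 * e)) ⟩
  12 + 3 * e         ≡⟨ solve 1 (λ e → con 12 :+ con 3 :* e := con 3 :* (con 4 :+ e) :+ con 0) refl e ⟩
  3 * (4 + e) + 0    ∎))
  where open ≤-Reasoning; open +-*-Solver

-- Degree 3 gives nothing and keeps 6; degree `d ≥ 6` keeps at least 2d ∸ d ≥ 6. Degrees 4 and 5 can
-- spare 2 and 4 units, so they are overdrawn from the third and the fifth gift on.
poor-cases₃ : ∀ d S T → 2 * d + 𝟙 (d ℕ.≟ 2) * S < 6 + gift₃ d * T → T ≤ d →
        d ≤ 1 ⊎ (d ≡ 2 × S < 2) ⊎ (d ≡ 4 × 3 ≤ T) ⊎ (d ≡ 5 × 5 ≤ T)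
poor-cases₃ 0 S T lt T≤d = inj₁ z≤n
poor-cases₃ 1 S T lt T≤d = inj₁ ≤-refl
poor-cases₃ 2 S T lt T≤d = inj₂ (inj₁ (refl , subst (_< 2) (+-identityʳ S) (+-cancelˡ-< 4 _ _ lt)))
poor-cases₃ 3 S T lt T≤d = contradiction lt (<-irrefl refl)
poor-cases₃ 4 S T lt T≤d = inj₂ (inj₂ (inj₁ (refl , subst (3 ≤_) (*-identityˡ T) (+-cancelˡ-≤ 6 _ _ lt))))
poor-cases₃ 5 S T lt T≤d = inj₂ (inj₂ (inj₂ (refl , subst (5 ≤_) (*-identityˡ T) (+-cancelˡ-≤ 6 _ _ lt))))
poor-cases₃ (6+ e) S T lt T≤d = contradiction lt (≤⇒≯ (begin
  6 + 1 * T          ≤⟨ +-monoʳ-≤ 6 (≤-trans (≤-reflexive (*-identityˡ T)) T≤d) ⟩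
  12 + e             ≤⟨ +-monoʳ-≤ 12 (m≤m+n e (1 * e)) ⟩
  12 + 2 * e         ≡⟨ solve 1 (λ e → con 12 :+ con 2 :* e := con 2 :* (con 6 :+ e) :+ con 0) refl e ⟩
  2 * (6 + e) + 0    ∎))
  where open ≤-Reasoning; open +-*-Solver

-- One neighbour of degree at least 4, or two of degree at least 3, would already supply 2. The
-- trailing `+ 0` is the empty tail of `sumOver` on a list of two neighbours.
small-gifts₁ : ∀ a b → gift₁ a + (gift₁ b + 0) < 2 → (a ≤ 2 × b ≤ 3) ⊎ (b ≤ 2 × a ≤ 3)
small-gifts₁ a b lt with a ℕ.≤? 2 | b ℕ.≤? 2 | a ℕ.≤? 3 | b ℕ.≤? 3
... | yes a≤2 | _       | _       | yes b≤3 = inj₁ (a≤2 , b≤3)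
... | _       | yes b≤2 | yes a≤3 | _       = inj₂ (b≤2 , a≤3)
... | _       | _       | no a≰3  | _       with s≤s (s≤s (s≤s (s≤s _))) ← ≰⇒> a≰3 = contradiction lt λ { (s≤s (s≤s ())) }
... | _       | _       | _       | no b≰3  with s≤s (s≤s (s≤s (s≤s _))) ← ≰⇒> b≰3 =
  contradiction lt (≤⇒≯ (m≤n+m 2 (gift₁ a)))
... | no a≰2  | no b≰2  | _       | _       =
  contradiction lt (≤⇒≯ (+-mono-≤ (1≤gift₁ (≰⇒> a≰2)) (+-monoˡ-≤ 0 (1≤gift₁ (≰⇒> b≰2)))))
  where
  1≤gift₁ : ∀ {d} → 3 ≤ d → 1 ≤ gift₁ d
  1≤gift₁ {3}    _ = ≤-refl
  1≤gift₁ {4+ _} _ = s≤s z≤n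
  1≤gift₁ {1} (s≤s ())
  1≤gift₁ {2} (s≤s (s≤s ()))

small-gifts₂ : ∀ a b → gift₂ a + (gift₂ b + 0) < 2 → a ≤ 2 ⊎ b ≤ 2
small-gifts₂ a b lt with a ℕ.≤? 2 | b ℕ.≤? 2
... | yes a≤2 | _       = inj₁ a≤2
... | no _    | yes b≤2 = inj₂ b≤2
... | no a≰2  | no b≰2  with s≤s (s≤s (s≤s _)) ← ≰⇒> a≰2 | s≤s (s≤s (s≤s _)) ← ≰⇒> b≰2 = contradiction lt λ { (s≤s (s≤s ())) }

small-gifts₃ : ∀ a b → gift₃ a + (gift₃ b + 0) < 2 → a ≤ 3 ⊎ b ≤ 3
small-gifts₃ a b lt with a ℕ.≤? 3 | b ℕ.≤? 3
... | yes a≤3 | _       = inj₁ a≤3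
... | no _    | yes b≤3 = inj₂ b≤3
... | no a≰3  | no b≰3  with s≤s (s≤s (s≤s (s≤s _))) ← ≰⇒> a≰3 | s≤s (s≤s (s≤s (s≤s _))) ← ≰⇒> b≰3 = contradiction lt λ { (s≤s (s≤s ())) }

-- Induction over sparse subgraphs

-- Final charge below `p`. The charge sent away is added on the right, because truncated subtraction
-- on the left would not be faithful.
Poor : (s p : ℕ) (gift : ℕ → ℕ) (H : Graph n) (v : Fin n) → Set
Poor s p gift H v = s * degree H v + 𝟙 (degree H v ℕ.≟ 2) * sumOver (gift ∘ degree H) (N H v) <
                    p + gift (degree H v) * count (degree H) 2 (N H v)

Sparse : ℕ → ℕ → Graph n → Set₁
Sparse s p G = ∀ H → H ⊑ G → 0 < order H → s * (2 * size H) < p * order H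

module _ {k t : ℕ} {L : ListAssignment n} (k≥4 : k ≥ 4) (t≥2 : 2 ≤ t) where

  private
    3≤k∸1 : 3 ≤ k ∸ 1
    3≤k∸1 = ∸-monoˡ-≤ 1 k≥4

    Reduction : ℕ → Graph n → Set₁
    Reduction q H = Admissible k t q L H → (∀ F → F ⊑ H → order F < order H → Colourable k L F) → Colourable k L H

    twos≤degree : ∀ (H : Graph n) v → count (degree H) 2 (N H v) ≤ degree H v
    twos≤degree H v = length-filter (λ u → degree H u ℕ.≟ 2) (N H v)

    pair-sum : ∀ {H : Graph n} {v a b} (g : ℕ → ℕ) → N H v ≡ a ∷ b ∷ [] → sumOver (g ∘ degree H) (N H v) < 2 →
               g (degree H a) + (g (degree H b) + 0) < 2
    pair-sum {H} g eq = subst (λ xs → sumOver (g ∘ degree H) xs < 2) eq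

    thread-reduction : ∀ {H v w u q} m d → Thread H w v u → degree H u ≤ m * (k ∸ 1) → degree H w ≤ d →
                       2 ≤ d → d ≤ 3 → m + d ≤ q → Reduction q H
    thread-reduction {H} {v} m d th deg-u deg-w 2≤d d≤3 m+d≤q adm smaller =
      reduce-thread k≥4 m d adm th deg-u deg-w 2≤d d≤3 m+d≤q
        (smaller (H − v) (−⊑ {H = H}) (order-− {H = H} (Adj⇒∈V H (Thread.vu th))))

    leaf-reduction : ∀ {H v} j → v ∈ˢ V H → degree H v ≤ 1 → Reduction (suc j + t) H
    leaf-reduction {H} {v} j v∈V deg≤1 adm smaller =
      reduce-leaf k≥4 adm v∈V (s≤s (m≤n+m t j)) deg≤1 (smaller (H − v) (−⊑ {H = H}) (order-− {H = H} v∈V))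

    degree-bound′ : ∀ {d} m → d ≤ m * 3 → d ≤ m * (k ∸ 1)
    degree-bound′ m d≤ = ≤-trans d≤ (*-monoʳ-≤ m 3≤k∸1)

  -- Both ends have degree at most 3 ≤ `k ∸ 1`, so `m` is 1, and one has degree at most 2. The cost
  -- 1 + 2 fits into `1 + t` because `t ≥ 2`.
  reduce₁ : ∀ {H v} → v ∈ˢ V H → Poor 5 12 gift₁ H v → Reduction (1 + t) H
  reduce₁ {H} {v} v∈V poor adm with poor-cases₁ _ _ _ poor (twos≤degree H v)
  ... | inj₁ deg≤1 = leaf-reduction 0 v∈V deg≤1 adm
  ... | inj₂ (deg≡2 , S<2) with degree-2⇒pair {H = H} deg≡2
  ...   | a , b , eq , th with small-gifts₁ _ _ (pair-sum {H = H} gift₁ eq S<2)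
  ...     | inj₁ (a≤2 , b≤3) = thread-reduction 1 2 th (degree-bound′ 1 b≤3) a≤2 ≤-refl (s≤s (s≤s z≤n)) (s≤s t≥2) adm
  ...     | inj₂ (b≤2 , a≤3) = thread-reduction 1 2 (Thread-sym th) (degree-bound′ 1 a≤3) b≤2 ≤-refl (s≤s (s≤s z≤n)) (s≤s t≥2) adm

  -- A thread with an end of degree at most 2 costs `t + 2`. A centre of degree 3 ≤ `k ∸ 1` has no
  -- saturated colour while a neighbour is uncoloured, which is the choice `σ` = 0.
  reduce₂ : ∀ {H v} → v ∈ˢ V H → Poor 3 8 gift₂ H v → Reduction (2 + t) H
  reduce₂ {H} {v} v∈V poor adm with poor-cases₂ _ _ _ poor (twos≤degree H v)
  ... | inj₁ deg≤1 = leaf-reduction 1 v∈V deg≤1 adm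
  ... | inj₂ (inj₁ (deg≡2 , S<2)) with degree-2⇒pair {H = H} deg≡2
  ...   | a , b , eq , th with small-gifts₂ _ _ (pair-sum {H = H} gift₂ eq S<2)
  ...     | inj₁ a≤2 = thread-reduction t 2 th (Admissible.degree-bound adm b) a≤2
                 ≤-refl (s≤s (s≤s z≤n)) (≤-reflexive (+-comm t 2)) adm
  ...     | inj₂ b≤2 = thread-reduction t 2 (Thread-sym th) (Admissible.degree-bound adm a) b≤2
                 ≤-refl (s≤s (s≤s z≤n)) (≤-reflexive (+-comm t 2)) adm
  reduce₂ {H} {v} v∈V poor adm | inj₂ (inj₂ (deg≡3 , 2≤T)) = reduce-centre k≥4 {H = H} 0 adm v∈V
    (degree-bound′ 1 (≤-reflexive deg≡3)) (≤-reflexive (cong 2+ (+-identityʳ t)))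
    (λ _ → ≤-trans (≤-reflexive deg≡3) (s≤s (s≤s (≤-trans (s≤s z≤n) t≥2))))
    (λ _ → ≤-reflexive (cong suc (trans (cong (λ m → t + m) deg≡3) (+-comm t 3))))
    (≤-trans (≤-reflexive deg≡3) (s≤s 2≤T)) (≤-trans (s≤s z≤n) 2≤T)

  -- A thread with an end of degree at most 3 costs `t + 3`. A centre of degree 4 or 5 is below 2 *
  -- 3 ≤ 2 * (`k ∸ 1`), which is the choice `σ` = 1.
  reduce₃ : ∀ {H v} → v ∈ˢ V H → Poor 2 6 gift₃ H v → Reduction (3 + t) H
  reduce₃ {H} {v} v∈V poor adm with poor-cases₃ _ _ _ poor (twos≤degree H v)
  ... | inj₁ deg≤1 = leaf-reduction 2 v∈V deg≤1 adm
  ... | inj₂ (inj₁ (deg≡2 , S<2)) with degree-2⇒pair {H = H} deg≡2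
  ...   | a , b , eq , th with small-gifts₃ _ _ (pair-sum {H = H} gift₃ eq S<2)
  ...     | inj₁ a≤3 = thread-reduction t 3 th (Admissible.degree-bound adm b) a≤3
                 (s≤s (s≤s z≤n)) ≤-refl (≤-reflexive (+-comm t 3)) adm
  ...     | inj₂ b≤3 = thread-reduction t 3 (Thread-sym th) (Admissible.degree-bound adm a) b≤3
                 (s≤s (s≤s z≤n)) ≤-refl (≤-reflexive (+-comm t 3)) adm
  reduce₃ {H} {v} v∈V poor adm | inj₂ (inj₂ (inj₁ (deg≡4 , 3≤T))) = reduce-centre k≥4 {H = H} 1 adm v∈V
    (degree-bound′ 2 (≤-trans (≤-reflexive deg≡4) (m≤m+n 4 2))) (≤-reflexive (cong 2+ (+-comm t 1)))
    (λ _ → ≤-trans (≤-reflexive deg≡4) (s≤s (s≤s (s≤s (≤-trans (s≤s z≤n) t≥2)))))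
    (λ _ → ≤-reflexive (cong suc (trans (cong (λ m → t + m) deg≡4) (+-comm t 4))))
    (≤-trans (≤-reflexive deg≡4) (s≤s 3≤T)) (≤-trans (s≤s z≤n) 3≤T)
  reduce₃ {H} {v} v∈V poor adm | inj₂ (inj₂ (inj₂ (deg≡5 , 5≤T))) = reduce-centre k≥4 {H = H} 1 adm v∈V
    (degree-bound′ 2 (≤-trans (≤-reflexive deg≡5) (m≤m+n 5 1))) (≤-reflexive (cong 2+ (+-comm t 1)))
    (λ _ → ≤-trans (≤-reflexive deg≡5) (s≤s (s≤s (s≤s t≥2))))
    -- A poor vertex of degree 5 has five neighbours of degree 2, so no other neighbour is left.
    (λ deg≡1+T → contradiction (subst (_≤ count (degree H) 2 (N H v)) (trans (sym deg≡5) deg≡1+T) 5≤T) 1+n≰n)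
    (≤-trans (≤-reflexive deg≡5) (m≤n⇒m≤1+n 5≤T)) (≤-trans (s≤s z≤n) 5≤T)

  -- Strong induction on the order over all subgraphs of `G`, since a star removes several vertices
  -- at once. Sparsity, lists and degree bounds are all inherited.
  colourable : ∀ {q} s p gift → (∀ {H v} → v ∈ˢ V H → Poor s p gift H v → Reduction q H) →
               ∀ {G} → Sparse s p G → Admissible k t q L G → Colourable k L G
  colourable {q} s p gift reduce {G} sparse adm = go (suc (order G)) G ⊑-refl ≤-refl
    where
    go : ∀ m H → H ⊑ G → order H < m → Colourable k L H
    go (suc m) H H⊑G ∣H∣<1+m with order H ℕ.≟ 0
    ... | no ∣H∣≢0 with discharging H gift s p (sparse H H⊑G (n≢0⇒n>0 ∣H∣≢0))
    ...   | v , v∈V , poor = reduce v∈V poor (Admissible-⊑ H⊑G adm)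
      λ F F⊑H ∣F∣<∣H∣ → go m F (⊑-trans F⊑H H⊑G) (<-≤-trans ∣F∣<∣H∣ (ℕ.s≤s⁻¹ ∣H∣<1+m))
    go (suc m) H H⊑G _ | yes ∣H∣≡0 = const 0 , record
      { proper   = λ uv → contradiction (Adj⇒∈V H uv) empty
      ; bounded  = λ u i → ≤-<-trans (length-filter (λ x → 0 ℕ.≟ i) (N H u))
                     (≤-<-trans (degree≤ H {xs = []} λ ux → contradiction (Adj⇒∈V H ux) empty) (≤-trans (s≤s z≤n) k≥4))
      ; coreFree = λ core _ Cx → let _ , _ , _ , (_ , xy) , _ = core Cx in empty (Adj⇒∈V H xy)
      ; listed   = λ v∈V → contradiction v∈V empty
      }
      where
      empty : ∀ {x} → ¬ x ∈ˢ V H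
      empty x∈V = contradiction (order-− {H = H} x∈V) (subst (λ m → ¬ order (H − _) < m) (sym ∣H∣≡0) λ ())

-- Forested colourings

-- The forested condition without quantification over pairs of colours: the two colours are read off
-- from two consecutive vertices of a cycle, or from a vertex and its neighbour. In this form it is
-- decidable and can be carried along a renaming of colours.
record IsLocallyForested (k : ℕ) (G : Graph n) (c : Coloring n) : Set where
  field
    proper  : ∀ {u v} → Adj G u v → c u ≢ c v
    acyclic : ∀ {v u us} → IsCycle G v (u ∷ us) → ¬ All (λ x → c x ≡ c v ⊎ c x ≡ c u) us
    bounded : ∀ {u w} → Adj G u w → count c (c w) (N G u) < k

∈-colorClass-∪⁺ : ∀ (c : Coloring n) i j {x} → c x ≡ i ⊎ c x ≡ j → x ∈ˢ colorClass c i ∪ colorClass c j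
∈-colorClass-∪⁺ c i j {x} = Subsetₚ.x∈p∪q⁺ ∘ Sum.map ∈class ∈class
  where
  ∈class : ∀ {i} → c x ≡ i → x ∈ˢ colorClass c i
  ∈class {i} cx≡i = Vecₚ.lookup⇒[]= x (colorClass c i)
    (trans (Vecₚ.lookup∘tabulate (λ v → does (c v ℕ.≟ i)) x) (dec-true (c x ℕ.≟ i) cx≡i))

∈-colorClass-∪⁻ : ∀ (c : Coloring n) i j {x} → x ∈ˢ colorClass c i ∪ colorClass c j → c x ≡ i ⊎ c x ≡ j
∈-colorClass-∪⁻ c i j {x} = Sum.map (class∋ i) (class∋ j) ∘ Subsetₚ.x∈p∪q⁻ (colorClass c i) (colorClass c j)
  where
  class∋ : ∀ i → x ∈ˢ colorClass c i → c x ≡ i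
  class∋ i x∈ = decidable-stable (c x ℕ.≟ i) λ cx≢i → case
    trans (sym (dec-false (c x ℕ.≟ i) cx≢i))
          (trans (sym (Vecₚ.lookup∘tabulate (λ v → does (c v ℕ.≟ i)) x)) (Vecₚ.[]=⇒lookup x∈)) of λ ()

Linked-zip : ∀ {R S : A → A → Set} {P : A → Set} → (∀ {x y} → R x y → P x → P y → S x y) →
             ∀ {xs} → Linked R xs → All P xs → Linked S xs
Linked-zip f Linked.[]        _                = Linked.[]
Linked-zip f [-]              _                = [-]
Linked-zip f (xy ∷ linked) (px ∷ py ∷ pxs) = f xy px py ∷ Linked-zip f linked (py ∷ pxs)

Linked-init : ∀ {R : A → A → Set} xs {z} → Linked R (xs ∷ʳ z) → All (λ x → ∃ (R x)) xs
Linked-init []           _                = []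
Linked-init (x ∷ [])     (xz ∷ _)         = (_ , xz) ∷ []
Linked-init (x ∷ y ∷ xs) (xy ∷ linked)    = (_ , xy) ∷ Linked-init (y ∷ xs) linked

IsCycle-map : ∀ {F H : Graph n} {v vs} → (∀ {x y} → x ∈ v ∷ vs → y ∈ v ∷ vs → Adj F x y → Adj H x y) →
              IsCycle F v vs → IsCycle H v vs
IsCycle-map {v = v} {vs} f cycle = record
  { closed   = Linked-zip (λ xy x∈ y∈ → f x∈ y∈ xy) (IsCycle.closed cycle)
                 (here refl ∷ Allₚ.∷ʳ⁺ (All.tabulate there) (here refl))
  ; distinct = IsCycle.distinct cycle
  ; long     = IsCycle.long cycle
  }

module _ {k : ℕ} {G : Graph n} {c : Coloring n} where

  locally⇒forested : 0 < k → IsLocallyForested k G c → IsForestedColoring k G c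
  locally⇒forested 0<k local = record
    { proper    = Local.proper
    ; forest    = λ i j i≢j v vs → no-cycle i j v vs
    ; maxDegree = λ i j i≢j → let F = G [ colorClass c i ∪ colorClass c j ] in
        max<v⁺ {xs = map (degree F) (filter (λ x → x Subsetₚ.∈? V F) (allFin n))} 0<k
          (Allₚ.map⁺ (All.tabulate λ {u} _ → small i j u))
    }
    where
    module Local = IsLocallyForested local
    no-cycle : ∀ i j v vs → ¬ IsCycle (G [ colorClass c i ∪ colorClass c j ]) v vs
    no-cycle i j v [] cycle = case IsCycle.long cycle of λ ()
    no-cycle i j v (u ∷ us) cycle = Local.acyclic (IsCycle-map (λ _ _ → proj₁) cycle)
      (All.map (λ (_ , _ , x∈ , _) → two-colours (∈-colorClass-∪⁻ c i j x∈)) (All.tail (All.tail members)))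
      where
      members : All (λ x → ∃ (Adj (G [ colorClass c i ∪ colorClass c j ]) x)) (v ∷ u ∷ us)
      members = Linked-init (v ∷ u ∷ us) (IsCycle.closed cycle)
      vu = Linked.head (IsCycle.closed cycle)
      two-colours : ∀ {x} → c x ≡ i ⊎ c x ≡ j → c x ≡ c v ⊎ c x ≡ c u
      two-colours {x} cx with c x ℕ.≟ c u
      ... | yes cx≡cu = inj₂ cx≡cu
      ... | no cx≢cu  = inj₁ (two-valued cx (∈-colorClass-∪⁻ c i j (proj₂ (proj₂ vu))) (∈-colorClass-∪⁻ c i j (proj₁ (proj₂ vu)))
                                cx≢cu (Local.proper (proj₁ vu) ∘ sym))
    -- By alternation all neighbours of `u` in the union of two classes share the colour of any one
    -- of them, so a single count bounds the degree.
    small : ∀ i j u → degree (G [ colorClass c i ∪ colorClass c j ]) u < k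
    small i j u = small′ (N F u) refl
      where
      F = G [ colorClass c i ∪ colorClass c j ]
      small′ : ∀ xs → N F u ≡ xs → degree F u < k
      small′ [] eq = subst (λ xs → length xs < k) (sym eq) 0<k
      small′ (w ∷ _) eq = ≤-<-trans (Unique∧⊆⇒length≤ (N! F u) same) (Local.bounded (proj₁ uw))
        where
        uw = ∈N⁻ F (subst (w ∈_) (sym eq) (here refl))
        same : ∀ {x} → x ∈ N F u → x ∈ filter (λ x → c x ℕ.≟ c w) (N G u)
        same x∈ with ux , u∈ , x∈S ← ∈N⁻ F x∈ = ∈-filter⁺ (λ x → c x ℕ.≟ c w) (∈N⁺ G ux)
          (two-valued (∈-colorClass-∪⁻ c i j x∈S) (∈-colorClass-∪⁻ c i j u∈) (∈-colorClass-∪⁻ c i j (proj₂ (proj₂ uw)))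
                      (Local.proper ux ∘ sym) (Local.proper (proj₁ uw)))

  forested⇒locally : IsForestedColoring k G c → IsLocallyForested k G c
  forested⇒locally forested = record
    { proper  = Forested.proper
    ; acyclic = λ {v} {u} {us} cycle two-coloured → Forested.forest (c v) (c u)
        (Forested.proper (Linked.head (IsCycle.closed cycle))) v (u ∷ us)
        (IsCycle-map {F = G} {H = G [ colorClass c (c v) ∪ colorClass c (c u) ]}
          (λ x∈ y∈ xy → xy , coloured two-coloured x∈ , coloured two-coloured y∈) cycle)
    ; bounded = λ {u} {w} uw → ≤-<-trans (within u w uw)
        (≤-<-trans (All.lookup (xs≤max 0 (map (degree (F u w)) (filter (λ x → x Subsetₚ.∈? V (F u w)) (allFin n)))) (∈-map⁺ (degree (F u w))
                     (∈-filter⁺ (λ x → x Subsetₚ.∈? V (F u w)) (∈-allFin u)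
                       (Subsetₚ.x∈p∩q⁺ (Adj⇒∈V G uw , ∈-colorClass-∪⁺ c (c u) (c w) (inj₁ refl))))))
                   (Forested.maxDegree (c u) (c w) (Forested.proper uw)))
    }
    where
    module Forested = IsForestedColoring forested
    F : Fin n → Fin n → Graph n
    F u w = G [ colorClass c (c u) ∪ colorClass c (c w) ]
    coloured : ∀ {v u us} → All (λ x → c x ≡ c v ⊎ c x ≡ c u) us → ∀ {x} → x ∈ v ∷ u ∷ us →
               x ∈ˢ colorClass c (c v) ∪ colorClass c (c u)
    coloured {v} {u} all (here refl)         = ∈-colorClass-∪⁺ c (c v) (c u) (inj₁ refl)
    coloured {v} {u} all (there (here refl)) = ∈-colorClass-∪⁺ c (c v) (c u) (inj₂ refl)
    coloured {v} {u} all (there (there x∈))  = ∈-colorClass-∪⁺ c (c v) (c u) (All.lookup all x∈)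
    within : ∀ u w → Adj G u w → count c (c w) (N G u) ≤ degree (F u w) u
    within u w uw = Unique∧⊆⇒length≤ (Uniqueₚ.filter⁺ (λ x → c x ℕ.≟ c w) (N! G u)) λ x∈ →
      let x∈N , cx≡cw = ∈-filter⁻ (λ x → c x ℕ.≟ c w) {xs = N G u} x∈ in
      ∈N⁺ (F u w) (∈N⁻ G x∈N , ∈-colorClass-∪⁺ c (c u) (c w) (inj₁ refl) , ∈-colorClass-∪⁺ c (c u) (c w) (inj₂ cx≡cw))

  -- Vertices of equal colour under `c` have equal colour under `c′`, so every defect of `c` (an
  -- edge, a two-coloured cycle, a frequent colour) is a defect of `c′`.
  recolour : ∀ {c′} (ρ : ℕ → ℕ) → (∀ {v} → v ∈ˢ V G → c′ v ≡ ρ (c v)) →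
             IsLocallyForested k G c′ → IsLocallyForested k G c
  recolour {c′} ρ c′≡ρ∘c local = record
    { proper  = λ uv cu≡cv → Local.proper uv (agree (Adj⇒∈V G uv) (Adj⇒∈Vʳ G uv) cu≡cv)
    ; acyclic = λ {v} {u} {us} cycle two-coloured →
        case Linked-init (v ∷ u ∷ us) (IsCycle.closed cycle) of λ { ((_ , vu) ∷ (_ , uy) ∷ nbrs) →
        Local.acyclic cycle (All.zipWith
          (λ ((_ , xy) , cx) → Sum.map (agree (Adj⇒∈V G xy) (Adj⇒∈V G vu)) (agree (Adj⇒∈V G xy) (Adj⇒∈V G uy)) cx)
          (nbrs , two-coloured)) }
    ; bounded = λ {u} {w} uw → ≤-<-trans
        (Unique∧⊆⇒length≤ (Uniqueₚ.filter⁺ (λ x → c x ℕ.≟ c w) (N! G u)) λ x∈ →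
          let x∈N , cx≡cw = ∈-filter⁻ (λ x → c x ℕ.≟ c w) {xs = N G u} x∈ in
          ∈-filter⁺ (λ x → c′ x ℕ.≟ c′ w) x∈N (agree (Adj⇒∈Vʳ G (∈N⁻ G x∈N)) (Adj⇒∈Vʳ G uw) cx≡cw))
        (Local.bounded uw)
    }
    where
    module Local = IsLocallyForested local
    agree : ∀ {u v} → u ∈ˢ V G → v ∈ˢ V G → c u ≡ c v → c′ u ≡ c′ v
    agree u∈V v∈V cu≡cv = trans (c′≡ρ∘c u∈V) (trans (cong ρ cu≡cv) (sym (c′≡ρ∘c v∈V)))

-- Each vertex of a cycle is adjacent to its predecessor and its successor, and these differ since
-- the cycle has at least three vertices.
IsCycle⇒IsCore : ∀ {G : Graph n} {v vs} → IsCycle G v vs → IsCore G (_∈ v ∷ vs)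
IsCycle⇒IsCore {G = G} {v} {vs} cycle = core
  where
  open IsCycle cycle
  last : ∀ x xs → Linked (Adj G) (x ∷ xs ∷ʳ v) → ∃ λ l → l ∈ x ∷ xs × Adj G v l
  last x []       (xv ∷ _)      = x , here refl , Graph.sym G xv
  last x (y ∷ xs) (_ ∷ linked) = let l , l∈ , vl = last y xs linked in l , there l∈ , vl
  -- `p` is the predecessor of the first vertex of `xs`, and the successor of the last one is `v`.
  -- The condition on `p ≡ v` excludes a closed walk from `v` to one vertex and back.
  interior : ∀ p xs → Linked (Adj G) (p ∷ xs ∷ʳ v) → Unique (p ∷ xs) → v ∉ xs → (p ≡ v → 2 ≤ length xs) →
             ∀ {x} → x ∈ xs → ∃₂ λ y z → y ≢ z × (y ∈ p ∷ xs × Adj G x y) × (z ∈ v ∷ xs × Adj G x z)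
  interior p (x ∷ []) (px ∷ xv ∷ _) _ _ 2≤ (here refl) =
    p , v , (λ p≡v → case 2≤ p≡v of λ { (s≤s ()) }) , (here refl , Graph.sym G px) , (here refl , xv)
  interior p (x ∷ y ∷ xs) (px ∷ xy ∷ _) ((_ ∷ p≢y ∷ _) ∷ _) _ _ (here refl) =
    p , y , p≢y , (here refl , Graph.sym G px) , (there (there (here refl)) , xy)
  interior p (x ∷ xs) (_ ∷ linked) (_ ∷ xs!) v∉ _ (there x∈)
    with y , z , y≢z , (y∈ , xy) , (z∈ , xz) ← interior x xs linked xs! (v∉ ∘ there) (λ x≡v → contradiction (here (sym x≡v)) v∉) x∈ =
    y , z , y≢z , (there y∈ , xy) , (v∷ z∈ , xz)
    where
    v∷ : ∀ {z} → z ∈ v ∷ xs → z ∈ v ∷ x ∷ xs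
    v∷ (here z≡v)  = here z≡v
    v∷ (there z∈) = there (there z∈)
  core : IsCore G (_∈ v ∷ vs)
  core (here refl) = ends vs closed distinct long
    where
    ends : ∀ vs → Linked (Adj G) (v ∷ vs ∷ʳ v) → Unique (v ∷ vs) → 2 ≤ length vs →
           ∃₂ λ y z → y ≢ z × (y ∈ v ∷ vs × Adj G v y) × (z ∈ v ∷ vs × Adj G v z)
    ends (x ∷ y ∷ ys) (vx ∷ _ ∷ linked) (_ ∷ x∉ ∷ _) _ with l , l∈ , vl ← last y ys linked =
      x , l , All.lookup x∉ l∈ , (there (here refl) , vx) , (there (there l∈) , vl)
    ends (_ ∷ []) _ _ (s≤s ())
  core (there x∈) = interior v vs closed distinct v∉vs (λ _ → long) x∈
    where
    v∉vs : v ∉ vs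
    v∉vs v∈ = case distinct of λ { (v≢ ∷ _) → All.lookup v≢ v∈ refl }

coreFree⇒locally : ∀ {k L} {G : Graph n} {c} → IsCoreFreeColoring k L G c → IsLocallyForested k G c
coreFree⇒locally {c = c} good = record
  { proper  = Good.proper
  ; acyclic = λ {v} {u} cycle two-coloured → Good.coreFree (IsCycle⇒IsCore cycle)
      (λ { (here refl) → inj₁ refl ; (there (here refl)) → inj₂ refl ; (there (there x∈)) → All.lookup two-coloured x∈ })
      (here refl)
  ; bounded = λ {u} {w} _ → Good.bounded u (c w)
  }
  where module Good = IsCoreFreeColoring good

-- Decidability of choosability

-- Finiteness as exhaustive search. Tables are vectors and not functions, so that the search meets
-- each table itself and not merely one pointwise equal to it.
Searchable : Set → Set₁
Searchable A = ∀ {P : A → Set} → (∀ a → Dec (P a)) → Dec (∃ P)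

Searchable-Vec : Searchable A → ∀ m → Searchable (Vec A m)
Searchable-Vec any zero    P? = map′ ([] ,_) (λ { ([] , p) → p }) (P? [])
Searchable-Vec any (suc m) P? = map′ (λ (a , as , p) → a ∷ as , p) (λ { (a ∷ as , p) → a , as , p })
  (any λ a → Searchable-Vec any m λ as → P? (a ∷ as))

all-searchable? : Searchable A → {P : A → Set} → (∀ a → Dec (P a)) → Dec (∀ a → P a)
all-searchable? any P? = map′ (λ none a → decidable-stable (P? a) λ ¬p → none (a , ¬p)) (λ all (a , ¬p) → ¬p (all a))
  (¬? (any (¬? ∘ P?)))

any-short-list? : ∀ m {P : List (Fin n) → Set} → (∀ xs → Dec (P xs)) → Dec (∃ λ xs → length xs ≤ m × P xs)
any-short-list? zero    P? = map′ (λ p → [] , z≤n , p) (λ { ([] , _ , p) → p }) (P? [])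
any-short-list? (suc m) P? = map′
  [ (λ p → [] , z≤n , p) , (λ (x , xs , ≤m , p) → x ∷ xs , s≤s ≤m , p) ]′
  (λ { ([] , _ , p) → inj₁ p ; (x ∷ xs , s≤s ≤m , p) → inj₂ (x , xs , ≤m , p) })
  (P? [] ⊎-dec Finₚ.any? λ x → any-short-list? m (P? ∘ (x ∷_)))

isCycle? : ∀ (G : Graph n) v vs → Dec (IsCycle G v vs)
isCycle? G v vs = map′ (λ (closed , distinct , long) → record { closed = closed ; distinct = distinct ; long = long })
  (λ cycle → IsCycle.closed cycle , IsCycle.distinct cycle , IsCycle.long cycle)
  (Linked.linked? (adj? G) (v ∷ (vs ∷ʳ v)) ×-dec DecUnique.unique? Fin._≟_ (v ∷ vs) ×-dec (2 ℕ.≤? length vs))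

-- Distinctness bounds the length, which makes the search for a two-coloured cycle finite.
cycle-length : ∀ {G : Graph n} {v u us} → IsCycle G v (u ∷ us) → length us ≤ n
cycle-length {n = n} {G} {v} {u} {us} cycle = ≤-trans (m≤n+m (length us) 2)
  (subst (length (v ∷ u ∷ us) ≤_) (length-tabulate id) (Unique∧⊆⇒length≤ (IsCycle.distinct cycle) λ {x} _ → ∈-allFin x))

isLocallyForested? : ∀ k (G : Graph n) c → Dec (IsLocallyForested k G c)
isLocallyForested? {n} k G c = map′
  (λ (proper , acyclic , bounded) → record
    { proper  = λ {u} {v} → proper u v
    ; acyclic = λ {v} {u} {us} cycle two-coloured → acyclic (v , u , us , cycle-length {G = G} cycle , cycle , two-coloured)
    ; bounded = λ {u} {w} → bounded u w })
  (λ local → (λ u v → IsLocallyForested.proper local) ,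
             (λ (v , u , us , _ , cycle , two-coloured) → IsLocallyForested.acyclic local cycle two-coloured) ,
             (λ u w → IsLocallyForested.bounded local))
  (Finₚ.all? (λ u → Finₚ.all? λ v → adj? G u v →-dec ¬? (c u ℕ.≟ c v)) ×-dec
   ¬? (Finₚ.any? λ v → Finₚ.any? λ u → any-short-list? n λ us →
        isCycle? G v (u ∷ us) ×-dec All.all? (λ x → (c x ℕ.≟ c v) ⊎-dec (c x ℕ.≟ c u)) us) ×-dec
   Finₚ.all? (λ u → Finₚ.all? λ w → adj? G u w →-dec (count c (c w) (N G u) ℕ.<? k)))

hasSize? : ∀ (G : Graph n) q L → Dec (HasSize G q L)
hasSize? G q L = Finₚ.all? λ v → (v Subsetₚ.∈? V G) →-dec (DecUnique.unique? ℕ._≟_ (L v) ×-dec (length (L v) ℕ.≟ q))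

-- Together with `nth` this translates colours into palette indices and back. An absent colour gets
-- the length of the list, so a palette of length `n * q` calls for `suc (n * q)` indices.
position : List ℕ → ℕ → ℕ
position []       x = 0
position (y ∷ ys) x = if does (x ℕ.≟ y) then 0 else suc (position ys x)

nth : List ℕ → ℕ → ℕ
nth []       i       = 0
nth (y ∷ ys) zero    = y
nth (y ∷ ys) (suc i) = nth ys i

position≤length : ∀ xs x → position xs x ≤ length xs
position≤length []       x = z≤n
position≤length (y ∷ ys) x with does (x ℕ.≟ y)
... | true  = z≤n
... | false = s≤s (position≤length ys x)

nth-position : ∀ {xs x} → x ∈ xs → nth xs (position xs x) ≡ x
nth-position {y ∷ ys} {x} x∈ with x ℕ.≟ y
... | yes refl rewrite dec-true (y ℕ.≟ y) refl = refl
nth-position {y ∷ ys} {x} (here x≡y) | no x≢y = contradiction x≡y x≢y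
nth-position {y ∷ ys} {x} (there x∈) | no x≢y rewrite dec-false (x ℕ.≟ y) x≢y = nth-position x∈

-- On `V G` the lists have length `q` and are kept; elsewhere padding or truncation makes an
-- arbitrary list fit into a table.
resize : ∀ q → List ℕ → Vec ℕ q
resize zero    _        = []
resize (suc q) []       = 0 ∷ resize q []
resize (suc q) (x ∷ xs) = x ∷ resize q xs

toList-resize : ∀ {q} xs → length xs ≡ q → Vec.toList (resize q xs) ≡ xs
toList-resize []       refl = refl
toList-resize (x ∷ xs) refl = cong (x ∷_) (toList-resize xs refl)

clamp : ∀ m → ℕ → Fin (suc m)
clamp m x = Fin.fromℕ< {m ℕ.⊓ x} (s≤s (m⊓n≤m m x))

toℕ-clamp : ∀ {m x} → x ≤ m → toℕ (clamp m x) ≡ x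
toℕ-clamp {m} {x} x≤m = trans (Finₚ.toℕ-fromℕ< (s≤s (m⊓n≤m m x))) (m≥n⇒m⊓n≡n x≤m)

-- At most n * q colours occur in lists of size q, so up to renaming every list
-- assignment is a table of colours 0 , … , n * q.
module _ (k : ℕ) (0<k : 0 < k) (G : Graph n) (q : ℕ) where

  private
    Table Palette-Coloring : Set
    Table            = Vec (Vec (Fin (suc (n * q))) q) n
    Palette-Coloring = Vec (Fin (suc (n * q))) n

    lists : Table → ListAssignment n
    lists T v = Vec.toList (Vec.map toℕ (Vec.lookup T v))

    colours : Palette-Coloring → Coloring n
    colours d v = toℕ (Vec.lookup d v)

  TableChoosable : Set
  TableChoosable = ∀ T → HasSize G q (lists T) →
    ∃ λ d → IsLocallyForested k G (colours d) × (∀ v → v ∈ˢ V G → colours d v ∈ lists T v)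

  tableChoosable? : Dec TableChoosable
  tableChoosable? = all-searchable? (Searchable-Vec (Searchable-Vec Finₚ.any? q) n) λ T →
    hasSize? G q (lists T) →-dec Searchable-Vec Finₚ.any? n λ d →
      isLocallyForested? k G (colours d) ×-dec Finₚ.all? λ v → (v Subsetₚ.∈? V G) →-dec (colours d v ∈ℕ? lists T v)

  choosable⇒table : ForestedChoosable k G q → TableChoosable
  choosable⇒table choosable T T-size = case choosable (lists T) T-size of λ { (c , forested , listed) →
    -- On `V G` the colours come from the table and are at most `n * q`, so clamping does not alter
    -- them.
    let d = Vec.tabulate (clamp (n * q) ∘ c)
        d≡c : ∀ {v} → v ∈ˢ V G → c v ≡ colours d v
        d≡c {v} v∈V = sym (trans (cong toℕ (Vecₚ.lookup∘tabulate (clamp (n * q) ∘ c) v))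
                                (toℕ-clamp (small (Vec.lookup T v) (listed v v∈V))))
    in d , recolour id d≡c (forested⇒locally forested) ,
       λ v v∈V → subst (_∈ lists T v) (d≡c v∈V) (listed v v∈V) }
    where
    small : ∀ {m b x} (xs : Vec (Fin (suc b)) m) → x ∈ Vec.toList (Vec.map toℕ xs) → x ≤ b
    small (i ∷ xs) (here refl) = ℕ.s≤s⁻¹ (Finₚ.toℕ<n i)
    small (i ∷ xs) (there x∈)  = small xs x∈

  -- The lists are renamed by `position palette`, which is injective on the palette, and the
  -- colouring found for the table is renamed back by `nth palette`. Renaming the result again by
  -- `position palette` returns the colouring found, as `recolour` requires.
  table⇒choosable : TableChoosable → ForestedChoosable k G q
  table⇒choosable table L L-size = case table T T-size of λ { (d , local , listed) →
    let c = nth palette ∘ colours d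
        from-list : ∀ {v} → v ∈ˢ V G → c v ∈ L v × colours d v ≡ position palette (c v)
        from-list {v} v∈V = case ∈-map⁻ (position palette) (subst (colours d v ∈_) (lists≡ v∈V) (listed v v∈V)) of
          λ { (x , x∈Lv , eq) →
            let cv≡x = trans (cong (nth palette) eq) (nth-position (∈palette v∈V x∈Lv)) in
            subst (_∈ L v) (sym cv≡x) x∈Lv , trans eq (cong (position palette) (sym cv≡x)) }
    in c , locally⇒forested 0<k (recolour (position palette) (proj₂ ∘ from-list) local) , λ v v∈V → proj₁ (from-list v∈V) }
    where
    palette : List ℕ
    palette = Vec.toList (Vec.concat (Vec.tabulate (λ v → resize q (L v))))
    T : Table
    T = Vec.tabulate (λ v → Vec.map (clamp (n * q) ∘ position palette) (resize q (L v)))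
    L≡ : ∀ {v} → v ∈ˢ V G → Vec.toList (resize q (L v)) ≡ L v
    L≡ v∈V = toList-resize _ (proj₂ (L-size _ v∈V))
    ∈palette : ∀ {v x} → v ∈ˢ V G → x ∈ L v → x ∈ palette
    ∈palette {v} {x} v∈V x∈ = ∈-toList⁺ (VecAnyₚ.concat⁺ (toAny (∈-tabulate⁺ (λ v → resize q (L v)) v)
      (∈-toList⁻ (subst (x ∈_) (sym (L≡ v∈V)) x∈))))
    lists≡ : ∀ {v} → v ∈ˢ V G → lists T v ≡ map (position palette) (L v)
    lists≡ {v} v∈V = begin
      Vec.toList (Vec.map toℕ (Vec.lookup T v))
        ≡⟨ cong (Vec.toList ∘ Vec.map toℕ) (Vecₚ.lookup∘tabulate _ v) ⟩
      Vec.toList (Vec.map toℕ (Vec.map (clamp (n * q) ∘ position palette) (resize q (L v))))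
        ≡⟨ cong Vec.toList (Vecₚ.map-∘ toℕ (clamp (n * q) ∘ position palette) (resize q (L v))) ⟨
      Vec.toList (Vec.map (toℕ ∘ clamp (n * q) ∘ position palette) (resize q (L v)))
        ≡⟨ cong Vec.toList (Vecₚ.map-cong (λ x → toℕ-clamp (≤-trans (position≤length palette x)
             (≤-reflexive (Vecₚ.length-toList (Vec.concat (Vec.tabulate (λ v → resize q (L v)))))))) (resize q (L v))) ⟩
      Vec.toList (Vec.map (position palette) (resize q (L v)))
        ≡⟨ Vecₚ.toList-map (position palette) (resize q (L v)) ⟩
      map (position palette) (Vec.toList (resize q (L v)))
        ≡⟨ cong (map (position palette)) (L≡ v∈V) ⟩
      map (position palette) (L v) ∎
      where open ≡-Reasoning
    T-size : HasSize G q (lists T)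
    T-size v v∈V with Lv! , ∣Lv∣≡q ← L-size v v∈V = subst (λ xs → Unique xs × length xs ≡ q) (sym (lists≡ v∈V))
      (Unique-map (λ x∈ y∈ eq → trans (sym (nth-position (∈palette v∈V x∈)))
                                      (trans (cong (nth palette) eq) (nth-position (∈palette v∈V y∈)))) Lv! ,
       trans (length-map (position palette) (L v)) ∣Lv∣≡q)
      where
      Unique-map : ∀ {f : ℕ → ℕ} {xs} → (∀ {x y} → x ∈ xs → y ∈ xs → f x ≡ f y → x ≡ y) → Unique xs → Unique (map f xs)
      Unique-map inj []         = []
      Unique-map inj (x∉ ∷ xs!) = Allₚ.map⁺ (All.tabulate λ y∈ fx≡fy → All.lookup x∉ y∈ (inj (here refl) (there y∈) fx≡fy)) ∷
                                  Unique-map (λ x∈ y∈ → inj (there x∈) (there y∈)) xs!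

  choosable? : Dec (ForestedChoosable k G q)
  choosable? = map′ table⇒choosable choosable⇒table tableChoosable?

least : ∀ {P : ℕ → Set} → (∀ m → Dec (P m)) → ∀ m → P m → ∃ λ l → P l × (∀ j → P j → l ≤ j) × l ≤ m
least P? m pm with P? 0
... | yes p₀ = 0 , p₀ , (λ _ _ → z≤n) , z≤n
least P? zero    p₀ | no ¬p₀ = contradiction p₀ ¬p₀
least P? (suc m) pm | no ¬p₀ with l , pl , least-l , l≤m ← least (P? ∘ suc) m pm =
  suc l , pl , (λ { zero p₀ → contradiction p₀ ¬p₀ ; (suc j) pj → s≤s (least-l j pj) }) , s≤s l≤m

choosable⇒choiceNumber : ∀ {k} {G : Graph n} {q} → 0 < k → ForestedChoosable k G q →
                         ∃ λ χ → IsForestedChoiceNumber k G χ × χ ≤ q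
choosable⇒choiceNumber {k = k} {G} {q} 0<k choosable
  with χ , choosable-χ , least-χ , χ≤q ← least (choosable? k 0<k G) q choosable =
  χ , record { choosable = choosable-χ ; least = least-χ } , χ≤q

-- Rational and integer arithmetic

-- The quotient is stored in lowest terms, so `a` and `b` are recovered only up to cross
-- multiplication.
↥-/-cross : ∀ a b .{{_ : NonZero b}} → ℚ.↥ (+ a ℚ./ b) ℤ.* + b ≡ + a ℤ.* ℚ.↧ (+ a ℚ./ b)
↥-/-cross a (suc b) with ℚₚ.toℚᵘ-fromℚᵘ (ℚᵘ.mkℚᵘ (+ a) b)
... | ℚᵘ.*≡* eq = trans (cong (ℤ._* + suc b) (sym (ℚₚ.↥ᵘ-toℚᵘ (+ a ℚ./ suc b))))
                        (trans eq (cong (+ a ℤ.*_) (ℚₚ.↧ᵘ-toℚᵘ (+ a ℚ./ suc b))))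

/-<-cross : ∀ a b c d .{{_ : NonZero b}} .{{_ : NonZero d}} → + a ℚ./ b ℚ.< + c ℚ./ d → a * d < c * b
/-<-cross a (suc b) c (suc d) lt
  with ℚᵘₚ.<-respʳ-≃ (ℚₚ.toℚᵘ-fromℚᵘ (ℚᵘ.mkℚᵘ (+ c) d))
         (ℚᵘₚ.<-respˡ-≃ (ℚₚ.toℚᵘ-fromℚᵘ (ℚᵘ.mkℚᵘ (+ a) b)) (ℚₚ.toℚᵘ-mono-< lt))
... | ℚᵘ.*<* ad<cb = ℤₚ.drop‿+<+ (subst₂ ℤ._<_ (sym (ℤₚ.pos-* a (suc d))) (sym (ℤₚ.pos-* c (suc b))) ad<cb)

-- The ceiling is the negated floor of `ℚ.- p`, which reduces the claim to the bound for integer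
-- division.
p≤⌈p⌉ : ∀ p → ℚ.↥ p ℤ.≤ ceiling p ℤ.* ℚ.↧ p
p≤⌈p⌉ p@record{} = ℤₚ.neg-cancel-≤ (begin
  ℤ.- (ceiling p ℤ.* ℚ.↧ p)                         ≡⟨ ℤₚ.neg-distribˡ-* (ceiling p) (ℚ.↧ p) ⟩
  ℤ.- ceiling p ℤ.* ℚ.↧ p                           ≡⟨ cong (ℤ._* ℚ.↧ p) (ℤₚ.neg-involutive (ℚ.floor (ℚ.- p))) ⟩
  ℚ.floor (ℚ.- p) ℤ.* ℚ.↧ p                         ≡⟨ cong (ℚ.floor (ℚ.- p) ℤ.*_) (ℚₚ.↧-neg p) ⟨
  ℚ.floor (ℚ.- p) ℤ.* ℚ.↧ (ℚ.- p)                   ≤⟨ ⌊p⌋≤p (ℚ.- p) ⟩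
  ℚ.↥ (ℚ.- p)                                       ≡⟨ ℚₚ.↥-neg p ⟩
  ℤ.- ℚ.↥ p                                         ∎)
  where
  open ℤₚ.≤-Reasoning
  ⌊p⌋≤p : ∀ p → ℚ.floor p ℤ.* ℚ.↧ p ℤ.≤ ℚ.↥ p
  ⌊p⌋≤p p@record{} = ℤᵈ.[n/d]*d≤n (ℚ.↥ p) (ℚ.↧ p)

⌈M/m⌉-bound : ∀ M m .{{_ : NonZero m}} → ∃ λ t → ceiling (+ M ℚ./ m) ≡ + t × M ≤ t * m
⌈M/m⌉-bound M m = natural (ceiling p) m (ℤₚ.*-cancelʳ-≤-pos (+ M) (ceiling p ℤ.* + m) (ℚ.↧ p) (begin
  + M ℤ.* ℚ.↧ p                    ≡⟨ ↥-/-cross M m ⟨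
  ℚ.↥ p ℤ.* + m                    ≤⟨ ℤₚ.*-monoʳ-≤-nonNeg (+ m) (p≤⌈p⌉ p) ⟩
  ceiling p ℤ.* ℚ.↧ p ℤ.* + m      ≡⟨ ℤₚ.*-assoc (ceiling p) (ℚ.↧ p) (+ m) ⟩
  ceiling p ℤ.* (ℚ.↧ p ℤ.* + m)    ≡⟨ cong (ceiling p ℤ.*_) (ℤₚ.*-comm (ℚ.↧ p) (+ m)) ⟩
  ceiling p ℤ.* (+ m ℤ.* ℚ.↧ p)    ≡⟨ ℤₚ.*-assoc (ceiling p) (+ m) (ℚ.↧ p) ⟨
  ceiling p ℤ.* + m ℤ.* ℚ.↧ p      ∎))
  where
  open ℤₚ.≤-Reasoning
  p : ℚ
  p = + M ℚ./ m
  natural : ∀ C m .{{_ : NonZero m}} → + M ℤ.≤ C ℤ.* + m → ∃ λ t → C ≡ + t × M ≤ t * m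
  natural (+ t)      m       M≤ = t , refl , ℤₚ.drop‿+≤+ (subst (+ M ℤ.≤_) (sym (ℤₚ.pos-* t m)) M≤)
  natural ℤ.-[1+ t ] (suc m) ()

mad⇒Sparse : ∀ {G : Graph n} {mad} p s .{{_ : NonZero s}} → IsMad G mad → mad ℚ.< + p ℚ./ s → Sparse s p G
mad⇒Sparse p s isMad mad<p/s H H⊑G 0<∣H∣ =
  subst (_< p * order H) (*-comm (2 * size H) s)
    (/-<-cross (2 * size H) (order H) p s (ℚₚ.≤-<-trans (IsMad.upperBound isMad H H⊑G) mad<p/s))
  where
  instance
    ∣H∣≢0 : NonZero (order H)
    ∣H∣≢0 = ℕ.>-nonZero 0<∣H∣

degree≤Δ : ∀ (G : Graph n) v → degree G v ≤ Δ G
degree≤Δ G v with v Subsetₚ.∈? V G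
... | yes v∈V = All.lookup (xs≤max 0 (map (degree G) (filter (Subsetₚ._∈? V G) (allFin _))))
                  (∈-map⁺ (degree G) (∈-filter⁺ (Subsetₚ._∈? V G) (∈-allFin v) v∈V))
... | no v∉V = ≤-trans (degree≤ G {xs = []} λ vu → contradiction (Adj⇒∈V G vu) v∉V) z≤n

theorem1p2 :
    ∀ {n} (G : Graph n) (M k : ℕ) → M ≥ k → (k≥4 : k ≥ 4) → Δ G ≤ M →
    ∀ (mad : ℚ) → IsMad G mad →
    let ⌈M/[k-1]⌉ : ℤ
        ⌈M/[k-1]⌉ = ceiling ((+ M ℚ./ (k ∸ 1)) {{k≥4⇒k∸1≢0 k≥4}})
    in
      (mad ℚ.< + 12 ℚ./ 5 →
        ∃[ χ ] (IsForestedChoiceNumber k G χ × (+ χ) ℤ.≤ ⌈M/[k-1]⌉ ℤ.+ + 1))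
    × (mad ℚ.< + 8 ℚ./ 3 →
        ∃[ χ ] (IsForestedChoiceNumber k G χ × (+ χ) ℤ.≤ ⌈M/[k-1]⌉ ℤ.+ + 2))
    × (mad ℚ.< + 3 ℚ./ 1 →
        ∃[ χ ] (IsForestedChoiceNumber k G χ × (+ χ) ℤ.≤ ⌈M/[k-1]⌉ ℤ.+ + 3))
theorem1p2 {n} G M k M≥k k≥4 Δ≤M mad isMad
  with t , ⌈⌉≡t , M≤t*[k-1] ← ⌈M/m⌉-bound M (k ∸ 1) {{k≥4⇒k∸1≢0 k≥4}} =
    (λ mad<12/5 → bound 1 5 12 gift₁ (reduce₁ k≥4 t≥2) (mad⇒Sparse 12 5 isMad mad<12/5)) ,
    (λ mad<8/3  → bound 2 3 8 gift₂ (reduce₂ k≥4 t≥2) (mad⇒Sparse 8 3 isMad mad<8/3)) ,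
    (λ mad<3    → bound 3 2 6 gift₃ (reduce₃ k≥4 t≥2) (doubled (mad⇒Sparse 3 1 isMad mad<3)))
  where
  0<k : 0 < k
  0<k = ≤-trans (s≤s z≤n) k≥4

  -- Here `M ≥ k` enters: `t ≤ 1` would give `M ≤ k ∸ 1 < k`.
  t≥2 : 2 ≤ t
  t≥2 = ≰⇒> λ t≤1 → <⇒≱ (≤-<-trans (*-monoˡ-≤ (k ∸ 1) t≤1) (≤-<-trans (≤-reflexive (*-identityˡ (k ∸ 1))) (k∸1<k k≥4)))
                         (≤-trans M≥k M≤t*[k-1])
    where
    k∸1<k : ∀ {k} → k ≥ 4 → k ∸ 1 < k
    k∸1<k (s≤s _) = ≤-refl

  -- With charges 1 and 3 a vertex of degree 2 lacks one unit and would receive halves from its two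
  -- neighbours; doubling keeps the gifts integral.
  doubled : Sparse 1 3 G → Sparse 2 6 G
  doubled sparse H H⊑G 0<∣H∣ = subst (2 * (2 * size H) <_) (sym (*-assoc 2 3 (order H)))
    (*-monoʳ-< 2 (subst (_< 3 * order H) (*-identityˡ (2 * size H)) (sparse H H⊑G 0<∣H∣)))

  bound : ∀ j s p gift →
    (∀ {L : ListAssignment n} {H v} → v ∈ˢ V H → Poor s p gift H v → Admissible k t (j + t) L H →
      (∀ F → F ⊑ H → order F < order H → Colourable k L F) → Colourable k L H) →
    Sparse s p G →
    ∃[ χ ] (IsForestedChoiceNumber k G χ × (+ χ) ℤ.≤ ceiling ((+ M ℚ./ (k ∸ 1)) {{k≥4⇒k∸1≢0 k≥4}}) ℤ.+ + j)
  bound j s p gift reduce sparse = case choosable⇒choiceNumber {k = k} {G} {j + t} 0<k choosable of λ { (χ , isχ , χ≤j+t) →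
    χ , isχ , subst (λ C → + χ ℤ.≤ C ℤ.+ + j) (sym ⌈⌉≡t) (ℤ.+≤+ (subst (χ ≤_) (+-comm j t) χ≤j+t)) }
    where
    choosable : ForestedChoosable k G (j + t)
    choosable L L-size = case colourable k≥4 t≥2 s p gift reduce sparse
        (record { lists = L-size ; degree-bound = λ v → ≤-trans (degree≤Δ G v) (≤-trans Δ≤M M≤t*[k-1]) }) of
      λ { (c , good) → c , locally⇒forested 0<k (coreFree⇒locally good) , λ v v∈V → IsCoreFreeColoring.listed good v∈V }
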